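{- For all integers $n\geq 4$, $m(n,3,K_4-e)=\frac{1}{3}\left(\binom{n}{2}-f(n)\right)$, where $$f(n)=\begin{cases} n/2+6 & \text{if } n\equiv 0 \text{ or } 2 \pmod 6,\\ 9 & \text{if } n\equiv 1\text{ or } 3\pmod 6,\\ n/2+4 & \text{if } n\equiv 4\pmod 6,\\ 7 & \text{if } n\equiv 5\pmod 6.\end{cases}$$
   Context: A 2-$(n,3,1)$ packing is a pair $(X,\mathcal{A})$ with $|X|=n$ and $\mathcal{A}$ a set of 3-subsets (blocks) of $X$ such that every 2-subset of $X$ lies in at most one block. Its leave is the graph on $X$ whose edges are the 2-subsets of $X$ contained in no block. For a graph $G$, $m(n,3,G)$ is the maximum number of blocks of a 2-$(n,3,1)$ packing whose leave contains a subgraph isomorphic to $G$. $K_4-e$ is the complete graph on 4 vertices with one edge removed. -}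

module Defs where

open import Data.Nat using (ℕ; zero; suc; _+_; _*_; _∸_; _≤_)
open import Data.Nat.DivMod using (_/_; _%_)
open import Data.Nat.Combinatorics using (_C_)
open import Data.Fin using (Fin)
open import Data.List using (List; length; lookup)
open import Data.Product using (Σ; ∃; ∃-syntax; _×_; _,_)
open import Data.Sum using (_⊎_)
open import Relation.Binary.PropositionalEquality using (_≡_; _≢_)
open import Relation.Nullary using (¬_)

-- A block: an (ordered presentation of a) 3-subset of the point set Fin n.
Triple : ℕ → Set
Triple n = Fin n × Fin n × Fin n

IsBlock : {n : ℕ} → Triple n → Set
IsBlock (a , b , c) = a ≢ b × a ≢ c × b ≢ c

_∈B_ : {n : ℕ} → Fin n → Triple n → Set
x ∈B (a , b , c) = x ≡ a ⊎ x ≡ b ⊎ x ≡ c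

PairIn : {n : ℕ} → Fin n → Fin n → Triple n → Set
PairIn x y B = x ∈B B × y ∈B B

-- A 2-(n,3,1) packing on X = Fin n: a list of blocks such that every
-- 2-subset {x,y} (x ≠ y) lies in at most one block (at most one position
-- of the list; in particular no block is repeated, so the list is a set
-- of 3-subsets and its length is the number of blocks).
IsPacking : (n : ℕ) → List (Triple n) → Set
IsPacking n bs =
  ((i : Fin (length bs)) → IsBlock (lookup bs i)) ×
  ((x y : Fin n) → x ≢ y → (i j : Fin (length bs)) →
     PairIn x y (lookup bs i) → PairIn x y (lookup bs j) → i ≡ j)

LeaveEdge : {n : ℕ} → List (Triple n) → Fin n → Fin n → Set
LeaveEdge bs x y = x ≢ y × ((i : Fin (length bs)) → ¬ PairIn x y (lookup bs i))

-- The leave contains a subgraph isomorphic to K4 - e: four distinct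
-- vertices a,b,c,d with edges ab, ac, ad, bc, bd in the leave (cd is the
-- removed edge; it may or may not be in the leave).
LeaveHasK4e : {n : ℕ} → List (Triple n) → Set
LeaveHasK4e {n} bs = ∃[ a ] ∃[ b ] ∃[ c ] ∃[ d ]
  (a ≢ b × a ≢ c × a ≢ d × b ≢ c × b ≢ d × c ≢ d ×
   LeaveEdge bs a b × LeaveEdge bs a c × LeaveEdge bs a d ×
   LeaveEdge bs b c × LeaveEdge bs b d)

IsMK4e : ℕ → ℕ → Set
IsMK4e n k =
  (Σ (List (Triple n)) λ bs → IsPacking n bs × LeaveHasK4e bs × length bs ≡ k) ×
  ((bs : List (Triple n)) → IsPacking n bs → LeaveHasK4e bs → length bs ≤ k)

-- f(n) from the theorem (n / 2 is exact in the even cases).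
fAux : ℕ → ℕ → ℕ
fAux n 0 = n / 2 + 6
fAux n 1 = 9
fAux n 2 = n / 2 + 6
fAux n 3 = 9
fAux n 4 = n / 2 + 4
fAux n _ = 7

f : ℕ → ℕ
f n = fAux n (n % 6)

-- Upper bound.  A point in r blocks has leave degree n − 1 − 2r, so all leave degrees have the
-- parity of n − 1.  For n odd this forces degree at least 4 at the two vertices of degree 3 of
-- K₄ − e and a further neighbour of positive even degree, hence 7 edges; for n even it forces
-- degree at least 3 at all four vertices and at least 1 elsewhere, hence n/2 + 4 edges.
-- The number of edges is congruent to n(n − 1)/2 modulo 3, which accounts for the remaining gaps.
--
-- Lower bound.  For n ≡ 1, 3 (mod 6) remove three blocks from a Steiner triple system (Skolem's
-- and Bose's constructions); for n ≡ 0, 2 delete a point of such a system, which leaves a perfect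
-- matching, and remove two more blocks.  For n ≡ 5 put one block into the hole of a system
-- with a hole of size 5; for n ≡ 4 delete a point of that hole, so that the leave is K₄
-- together with a perfect matching of the other points.
module Submission where

open import Defs
open import Data.Nat using (ℕ; zero; suc; _+_; _*_; _∸_; _≤_; _<_; z≤n; s≤s)
open import Data.Nat.Combinatorics using (_C_; nC1≡n; nCk+nC[k+1]≡[n+1]C[k+1])
open import Data.Nat.DivMod
  using (_%_; _/_; _mod_; m%n%n≡m%n; m%n<n; m<n⇒m%n≡m; m*n/n≡m; m≡m%n+[m/n]*n; [m+kn]%n≡m%n; %-distribˡ-+; %-distribˡ-*)
open import Data.Nat.Properties hiding (_≟_)
open import Data.Nat.Tactic.RingSolver using (solve-∀)
open import Data.Fin using (Fin; zero; suc; toℕ; combine; _≟_)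
import Data.Fin as Fin
open import Data.Fin.Patterns using (0F; 1F; 2F; 3F; 4F)
open import Data.Fin.Permutation using (cast-id)
import Data.Fin.Properties as Fin
open import Data.Bool using (Bool; true; false; if_then_else_)
open import Data.Empty using (⊥-elim)
open import Data.List using (List; []; _∷_; length; lookup; filter; allFin; cartesianProduct)
open import Data.List.Membership.Propositional using (_∈_)
open import Data.List.Membership.Propositional.Properties
  using (∈-lookup; ∈-filter⁺; ∈-filter⁻; ∈-cartesianProduct⁺; ∈-allFin)
import Data.List.Relation.Unary.All as All
open import Data.List.Relation.Unary.AllPairs using (_∷_)
open import Data.List.Relation.Unary.Any using (here; there; index)
open import Data.List.Relation.Unary.Any.Properties using (lookup-index)
open import Data.List.Relation.Unary.Unique.Propositional using (Unique)
import Data.List.Relation.Unary.Unique.Propositional.Properties as Unique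
open import Data.Maybe using (Maybe; just; nothing; _>>=_)
import Data.Maybe as Maybe
import Data.Maybe.Properties as Maybe
open import Data.Product using (∃-syntax; _×_; _,_; proj₁; proj₂)
open import Data.Product.Algebra using (×-comm)
open import Data.Product.Function.NonDependent.Propositional using (_×-↔_)
import Data.Product.Properties as Product
open import Data.Sum using (_⊎_; inj₁; inj₂)
open import Algebra.Properties.Semiring.Sum +-*-semiring
  using (sum; sum-cong-≗; ∑-distrib-+; ∑-comm; *-distribˡ-sum; *-distribʳ-sum)
open import Function using (_∘_; case_of_; _↔_; Inverse; mk↔ₛ′)
open import Function.Construct.Composition using (_↔-∘_)
open import Function.Construct.Identity using (↔-id)
open import Relation.Binary using (DecidableEquality; tri<; tri≈; tri>)
open import Relation.Binary.PropositionalEquality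
open import Relation.Nullary using (¬_; Dec; yes; no; does; ¬?)
open import Relation.Nullary.Decidable using (dec-true; dec-false; _×-dec_; _⊎-dec_)
open import Relation.Unary using (Decidable)
open Inverse using (to; from; strictlyInverseˡ; strictlyInverseʳ)

-- Leave degrees and the upper bound

-- The blocks of a construction are never counted. The identity between the degree sum of the leave
-- and the number of blocks turns an upper bound on the leave into a lower bound on the blocks, so a
-- construction only has to say which pairs stay uncovered. This is why triple systems appear as a
-- partial operation `third`: for distinct points `nothing` marks an uncovered pair, and the axioms
-- are equations that survive adding, deleting and relabelling points. Degree sums count every edge
-- twice, hence the doubled constants 14, n + 8 and 20. The hole has size 5 because K₅ minus a
-- triangle has 10 - 3 = 7 edges. The obstacle is to build the holed system: Bose's blocks without
-- the vertical triples leave triangles uncovered, and an odd cycle does not split into two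
-- matchings, so two new points cannot absorb it. Twisting one level by an involution merges these
-- triangles in pairs into hexagons, which do split; the triangle over the fixed point stays and
-- forms the hole with the two new points.

sum-mono : ∀ {n} {g h : Fin n → ℕ} → (∀ i → g i ≤ h i) → sum g ≤ sum h
sum-mono {zero}  g≤h = z≤n
sum-mono {suc n} g≤h = +-mono-≤ (g≤h zero) (sum-mono (g≤h ∘ suc))

sum-const : ∀ n c → sum {n} (λ _ → c) ≡ n * c
sum-const zero    c = refl
sum-const (suc n) c = cong (c +_) (sum-const n c)

sum-zero : ∀ {n} {g : Fin n → ℕ} → (∀ i → g i ≡ 0) → sum g ≡ 0
sum-zero {n} g≡0 = trans (sum-cong-≗ g≡0) (trans (sum-const n 0) (*-zeroʳ n))

term≤sum : ∀ {n} (g : Fin n → ℕ) i → g i ≤ sum g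
term≤sum g zero    = m≤m+n _ _
term≤sum g (suc i) = ≤-trans (term≤sum (g ∘ suc) i) (m≤n+m _ _)

sum≤1 : ∀ {n} (g : Fin n → ℕ) → (∀ i → g i ≤ 1) →
        (∀ i j → 1 ≤ g i → 1 ≤ g j → i ≡ j) → sum g ≤ 1
sum≤1 {zero}  g g≤1 unique = z≤n
sum≤1 {suc n} g g≤1 unique with g zero in eq
... | zero  = sum≤1 (g ∘ suc) (g≤1 ∘ suc)
                (λ i j p q → Fin.suc-injective (unique (suc i) (suc j) p q))
... | suc m = ≤-trans (+-mono-≤ (subst (_≤ 1) eq (g≤1 zero)) (≤-reflexive (sum-zero vanish))) ≤-refl
  where
  vanish : ∀ i → g (suc i) ≡ 0
  vanish i with g (suc i) in eq′
  ... | zero  = refl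
  ... | suc _ with () ← unique zero (suc i) (subst (1 ≤_) (sym eq) (s≤s z≤n))
                                          (subst (1 ≤_) (sym eq′) (s≤s z≤n))

⟦_⟧ : ∀ {P : Set} → Dec P → ℕ
⟦ p? ⟧ = if does p? then 1 else 0

⟦⟧-true : ∀ {P : Set} (p? : Dec P) → P → ⟦ p? ⟧ ≡ 1
⟦⟧-true p? p rewrite dec-true p? p = refl

⟦⟧-false : ∀ {P : Set} (p? : Dec P) → ¬ P → ⟦ p? ⟧ ≡ 0
⟦⟧-false p? ¬p rewrite dec-false p? ¬p = refl

⟦⟧≤1 : ∀ {P : Set} (p? : Dec P) → ⟦ p? ⟧ ≤ 1
⟦⟧≤1 (yes _) = ≤-refl
⟦⟧≤1 (no _)  = z≤n

⟦⟧-elim : ∀ {P : Set} (p? : Dec P) → 1 ≤ ⟦ p? ⟧ → P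
⟦⟧-elim (yes p) _ = p

δ : ∀ {n} → Fin n → Fin n → ℕ
δ x y = ⟦ x ≟ y ⟧

δ-refl : ∀ {n} (x : Fin n) → δ x x ≡ 1
δ-refl x = ⟦⟧-true (x ≟ x) refl

δ-≢ : ∀ {n} {x y : Fin n} → x ≢ y → δ x y ≡ 0
δ-≢ {x = x} {y} = ⟦⟧-false (x ≟ y)

sum-δ : ∀ {n} (k : Fin n) → sum (λ x → δ x k) ≡ 1
sum-δ k = ≤-antisym
  (sum≤1 _ (λ x → ⟦⟧≤1 (x ≟ k)) (λ x y p q → trans (⟦⟧-elim (x ≟ k) p) (sym (⟦⟧-elim (y ≟ k) q))))
  (≤-trans (≤-reflexive (sym (δ-refl k))) (term≤sum (λ x → δ x k) k))

-- Counts `x` with multiplicity, as a sum of deltas, so that sums over points split term by term; on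
-- a block it is the 0/1 indicator.
mem : ∀ {n} → Fin n → Triple n → ℕ
mem x (a , b , c) = δ x a + δ x b + δ x c

mem-∈ : ∀ {n} {x : Fin n} B → IsBlock B → x ∈B B → mem x B ≡ 1
mem-∈ {x = x} (_ , b , c) (a≢b , a≢c , b≢c) (inj₁ refl)
  rewrite δ-refl x | δ-≢ a≢b | δ-≢ a≢c = refl
mem-∈ {x = x} (a , _ , c) (a≢b , a≢c , b≢c) (inj₂ (inj₁ refl))
  rewrite δ-refl x | δ-≢ (a≢b ∘ sym) | δ-≢ b≢c = refl
mem-∈ {x = x} (a , b , _) (a≢b , a≢c , b≢c) (inj₂ (inj₂ refl))
  rewrite δ-refl x | δ-≢ (a≢c ∘ sym) | δ-≢ (b≢c ∘ sym) = refl

mem-∉ : ∀ {n} {x : Fin n} B → ¬ (x ∈B B) → mem x B ≡ 0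
mem-∉ (a , b , c) x∉B
  rewrite δ-≢ (x∉B ∘ inj₁) | δ-≢ (x∉B ∘ inj₂ ∘ inj₁) | δ-≢ (x∉B ∘ inj₂ ∘ inj₂) = refl

_∈B?_ : ∀ {n} (x : Fin n) B → Dec (x ∈B B)
x ∈B? (a , b , c) = x ≟ a ⊎-dec (x ≟ b ⊎-dec x ≟ c)

PairIn? : ∀ {n} (x y : Fin n) B → Dec (PairIn x y B)
PairIn? x y B = x ∈B? B ×-dec y ∈B? B

sum-mem : ∀ {n} (B : Triple n) → sum (λ x → mem x B) ≡ 3
sum-mem (a , b , c) = begin
  sum (λ x → δ x a + δ x b + δ x c)
    ≡⟨ ∑-distrib-+ (λ x → δ x a + δ x b) (λ x → δ x c) ⟩
  sum (λ x → δ x a + δ x b) + sum (λ x → δ x c)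
    ≡⟨ cong₂ _+_ (∑-distrib-+ (λ x → δ x a) (λ x → δ x b)) (sum-δ c) ⟩
  sum (λ x → δ x a) + sum (λ x → δ x b) + 1
    ≡⟨ cong₂ (λ u v → u + v + 1) (sum-δ a) (sum-δ b) ⟩
  3 ∎
  where open ≡-Reasoning

-- Double counting in a packing

module Counting {n : ℕ} (bs : List (Triple n)) (packing : IsPacking n bs) where

  private
    B : Fin (length bs) → Triple n
    B = lookup bs

    block : ∀ i → IsBlock (B i)
    block = proj₁ packing

  -- A product of memberships, so that summing over `y` factors; off the diagonal it counts the
  -- blocks through the pair, on the diagonal it is the replication number.
  covered : Fin n → Fin n → ℕ
  covered x y = sum (λ i → mem x (B i) * mem y (B i))

  replication : Fin n → ℕ
  replication x = sum (λ i → mem x (B i))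

  -- The adjacency matrix of the leave. Truncated subtraction loses nothing, because `covered` is at
  -- most 1 off the diagonal.
  leave : Fin n → Fin n → ℕ
  leave x y with x ≟ y
  ... | yes _ = 0
  ... | no  _ = 1 ∸ covered x y

  leaveDegree : Fin n → ℕ
  leaveDegree x = sum (leave x)

  mem-idem : ∀ x i → mem x (B i) * mem x (B i) ≡ mem x (B i)
  mem-idem x i with x ∈B? B i
  ... | yes x∈ rewrite mem-∈ (B i) (block i) x∈ = refl
  ... | no  x∉ rewrite mem-∉ (B i) x∉ = refl

  mem-mem : ∀ x y i → mem x (B i) * mem y (B i) ≡ ⟦ PairIn? x y (B i) ⟧
  mem-mem x y i with x ∈B? B i | y ∈B? B i
  ... | yes x∈ | yes y∈ = trans (cong₂ _*_ (mem-∈ (B i) (block i) x∈) (mem-∈ (B i) (block i) y∈))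
                            (sym (⟦⟧-true (PairIn? x y (B i)) (x∈ , y∈)))
  ... | yes _  | no  y∉ = trans (cong (mem x (B i) *_) (mem-∉ (B i) y∉))
                            (trans (*-zeroʳ (mem x (B i)))
                              (sym (⟦⟧-false (PairIn? x y (B i)) (y∉ ∘ proj₂))))
  ... | no  x∉ | _      = trans (cong (_* mem y (B i)) (mem-∉ (B i) x∉))
                            (sym (⟦⟧-false (PairIn? x y (B i)) (x∉ ∘ proj₁)))

  covered≡ : ∀ x y → covered x y ≡ sum (λ i → ⟦ PairIn? x y (B i) ⟧)
  covered≡ x y = sum-cong-≗ (mem-mem x y)

  covered≤1 : ∀ {x y} → x ≢ y → covered x y ≤ 1
  covered≤1 {x} {y} x≢y = subst (_≤ 1) (sym (covered≡ x y))
    (sum≤1 _ (λ i → ⟦⟧≤1 (PairIn? x y (B i)))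
      (λ i j p q → proj₂ packing x y x≢y i j
        (⟦⟧-elim (PairIn? x y (B i)) p) (⟦⟧-elim (PairIn? x y (B j)) q)))

  covered-0 : ∀ {x y} → (∀ i → ¬ PairIn x y (B i)) → covered x y ≡ 0
  covered-0 {x} {y} none = trans (covered≡ x y) (sum-zero (λ i → ⟦⟧-false (PairIn? x y (B i)) (none i)))

  covered-≥1 : ∀ {x y} i → PairIn x y (B i) → 1 ≤ covered x y
  covered-≥1 {x} {y} i xy∈ = subst (1 ≤_) (sym (covered≡ x y))
    (≤-trans (≤-reflexive (sym (⟦⟧-true (PairIn? x y (B i)) xy∈))) (term≤sum _ i))

  leave-edge : ∀ {x y} → LeaveEdge bs x y → leave x y ≡ 1
  leave-edge {x} {y} (x≢y , none) with x ≟ y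
  ... | yes x≡y = ⊥-elim (x≢y x≡y)
  ... | no  _   = cong (1 ∸_) (covered-0 none)

  leave-covered : ∀ {x y} i → PairIn x y (B i) → leave x y ≡ 0
  leave-covered {x} {y} i xy∈ with x ≟ y
  ... | yes _ = refl
  ... | no  _ = m≤n⇒m∸n≡0 (covered-≥1 i xy∈)

  leave-diagonal : ∀ x → leave x x ≡ 0
  leave-diagonal x with x ≟ x
  ... | yes _   = refl
  ... | no  x≢x = ⊥-elim (x≢x refl)

  leave≤1 : ∀ x y → leave x y ≤ 1
  leave≤1 x y with x ≟ y
  ... | yes _ = z≤n
  ... | no  _ = m∸n≤m 1 (covered x y)

  covered-sym : ∀ x y → covered x y ≡ covered y x
  covered-sym x y = sum-cong-≗ (λ i → *-comm (mem x (B i)) (mem y (B i)))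

  leave-sym : ∀ x y → leave x y ≡ leave y x
  leave-sym x y with x ≟ y | y ≟ x
  ... | yes _   | yes _   = refl
  ... | yes x≡y | no  y≢x = ⊥-elim (y≢x (sym x≡y))
  ... | no  x≢y | yes y≡x = ⊥-elim (x≢y (sym y≡x))
  ... | no  _   | no  _   = cong (1 ∸_) (covered-sym x y)

  -- One equation for both cases, ready to be summed over `y`: the delta terms correct the diagonal,
  -- where `leave` is 0 and `covered` is the replication number.
  pair-identity : ∀ x y → leave x y + covered x y + δ y x ≡ 1 + δ y x * replication x
  pair-identity x y with x ≟ y
  ... | yes refl rewrite δ-refl x | sum-cong-≗ (mem-idem x) | +-identityʳ (replication x) =
          +-comm (replication x) 1
  ... | no x≢y rewrite δ-≢ (x≢y ∘ sym) | m∸n+n≡m (covered≤1 x≢y) = refl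

  sum-covered : ∀ x → sum (covered x) ≡ 3 * replication x
  sum-covered x = begin
    sum (λ y → sum (λ i → mem x (B i) * mem y (B i)))
      ≡⟨ ∑-comm (λ y i → mem x (B i) * mem y (B i)) ⟩
    sum (λ i → sum (λ y → mem x (B i) * mem y (B i)))
      ≡⟨ sum-cong-≗ (λ i → sym (*-distribˡ-sum (mem x (B i)) (λ y → mem y (B i)))) ⟩
    sum (λ i → mem x (B i) * sum (λ y → mem y (B i)))
      ≡⟨ sum-cong-≗ (λ i → trans (cong (mem x (B i) *_) (sum-mem (B i))) (*-comm (mem x (B i)) 3)) ⟩
    sum (λ i → 3 * mem x (B i))
      ≡⟨ sym (*-distribˡ-sum 3 (λ i → mem x (B i))) ⟩
    3 * replication x ∎
    where open ≡-Reasoning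

  sum-replication : sum replication ≡ 3 * length bs
  sum-replication = begin
    sum (λ x → sum (λ i → mem x (B i)))  ≡⟨ ∑-comm (λ x i → mem x (B i)) ⟩
    sum (λ i → sum (λ x → mem x (B i)))  ≡⟨ sum-cong-≗ (λ i → sum-mem (B i)) ⟩
    sum {length bs} (λ _ → 3)            ≡⟨ sum-const (length bs) 3 ⟩
    length bs * 3                        ≡⟨ *-comm (length bs) 3 ⟩
    3 * length bs                        ∎
    where open ≡-Reasoning

  degree-identity : ∀ x → leaveDegree x + 2 * replication x + 1 ≡ n
  -- The cancelled `replication x` is the diagonal entry of `covered`, which the total
  -- `3 * replication x` includes.
  degree-identity x = +-cancelʳ-≡ (replication x) _ _ (begin
    leaveDegree x + 2 * r + 1 + r
      ≡⟨ regroup (leaveDegree x) r ⟩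
    leaveDegree x + 3 * r + 1
      ≡⟨ cong₂ (λ u v → leaveDegree x + u + v) (sum-covered x) (sum-δ x) ⟨
    leaveDegree x + sum (covered x) + sum (λ y → δ y x)
      ≡⟨ cong (_+ sum (λ y → δ y x)) (∑-distrib-+ (leave x) (covered x)) ⟨
    sum (λ y → leave x y + covered x y) + sum (λ y → δ y x)
      ≡⟨ ∑-distrib-+ (λ y → leave x y + covered x y) (λ y → δ y x) ⟨
    sum (λ y → leave x y + covered x y + δ y x)
      ≡⟨ sum-cong-≗ (pair-identity x) ⟩
    sum (λ y → 1 + δ y x * r)
      ≡⟨ ∑-distrib-+ (λ _ → 1) (λ y → δ y x * r) ⟩
    sum {n} (λ _ → 1) + sum (λ y → δ y x * r)
      ≡⟨ cong₂ _+_ (trans (sum-const n 1) (*-identityʳ n))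
           (trans (sym (*-distribʳ-sum r (λ y → δ y x))) (trans (cong (_* r) (sum-δ x)) (*-identityˡ r))) ⟩
    n + r ∎)
    where
    open ≡-Reasoning
    r = replication x
    regroup : ∀ d r → d + 2 * r + 1 + r ≡ d + 3 * r + 1
    regroup = solve-∀

  total-identity : sum leaveDegree + 6 * length bs + n ≡ n * n
  total-identity = begin
    sum leaveDegree + 6 * length bs + n
      ≡⟨ cong₂ (λ u v → sum leaveDegree + u + v) (regroup (length bs))
           (sym (trans (sum-const n 1) (*-identityʳ n))) ⟩
    sum leaveDegree + 2 * (3 * length bs) + sum {n} (λ _ → 1)
      ≡⟨ cong (λ u → sum leaveDegree + 2 * u + sum {n} (λ _ → 1)) sum-replication ⟨
    sum leaveDegree + 2 * sum replication + sum {n} (λ _ → 1)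
      ≡⟨ cong (λ u → sum leaveDegree + u + sum {n} (λ _ → 1)) (*-distribˡ-sum 2 replication) ⟩
    sum leaveDegree + sum (λ x → 2 * replication x) + sum {n} (λ _ → 1)
      ≡⟨ cong (_+ sum {n} (λ _ → 1)) (∑-distrib-+ leaveDegree (λ x → 2 * replication x)) ⟨
    sum (λ x → leaveDegree x + 2 * replication x) + sum {n} (λ _ → 1)
      ≡⟨ ∑-distrib-+ (λ x → leaveDegree x + 2 * replication x) (λ _ → 1) ⟨
    sum (λ x → leaveDegree x + 2 * replication x + 1)
      ≡⟨ sum-cong-≗ degree-identity ⟩
    sum {n} (λ _ → n)
      ≡⟨ sum-const n n ⟩
    n * n ∎
    where
    open ≡-Reasoning
    regroup : ∀ l → 6 * l ≡ 2 * (3 * l)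
    regroup = solve-∀

-- The equation makes `d` even, so an odd lower bound gains 1. Halving `2k + 2r < 2m` and doubling
-- the result performs this without a parity predicate.
even-round-up : ∀ k {d r m} → d + 2 * r ≡ 2 * m → suc (2 * k) ≤ d → 2 * suc k ≤ d
even-round-up k {d} {r} {m} eq k<d = +-cancelʳ-≤ (2 * r) _ _ (begin
  2 * suc k + 2 * r  ≡⟨ *-distribˡ-+ 2 (suc k) r ⟨
  2 * (suc k + r)    ≤⟨ *-monoʳ-≤ 2 (*-cancelˡ-< 2 (k + r) m (begin-strict
    2 * (k + r)         ≡⟨ *-distribˡ-+ 2 k r ⟩
    2 * k + 2 * r       <⟨ +-monoˡ-≤ (2 * r) k<d ⟩
    d + 2 * r           ≡⟨ eq ⟩
    2 * m               ∎)) ⟩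
  2 * m              ≡⟨ eq ⟨
  d + 2 * r          ∎)
  where open ≤-Reasoning

module LeaveBounds {n : ℕ} (bs : List (Triple n)) (packing : IsPacking n bs) where
  open Counting bs packing

  neighbours-2 : ∀ {x y z} → y ≢ z → LeaveEdge bs x y → LeaveEdge bs x z → 2 ≤ leaveDegree x
  neighbours-2 {x} {y} {z} y≢z xy xz = subst (_≤ leaveDegree x)
    (trans (∑-distrib-+ (λ u → δ u y) (λ u → δ u z)) (cong₂ _+_ (sum-δ y) (sum-δ z)))
    (sum-mono bound)
    where
    bound : ∀ u → δ u y + δ u z ≤ leave x u
    bound u with u ≟ y
    ... | yes refl rewrite δ-≢ y≢z = ≤-reflexive (sym (leave-edge xy))
    ... | no _ with u ≟ z
    ...   | yes refl = ≤-reflexive (sym (leave-edge xz))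
    ...   | no _ = z≤n

  neighbours-3 : ∀ {x y z w} → y ≢ z → y ≢ w → z ≢ w →
    LeaveEdge bs x y → LeaveEdge bs x z → LeaveEdge bs x w → 3 ≤ leaveDegree x
  neighbours-3 {x} {y} {z} {w} y≢z y≢w z≢w xy xz xw = subst (_≤ leaveDegree x) (sum-mem (y , z , w))
    (sum-mono bound)
    where
    bound : ∀ u → mem u (y , z , w) ≤ leave x u
    bound u with u ∈B? (y , z , w)
    ... | no u∉ = subst (_≤ leave x u) (sym (mem-∉ (y , z , w) u∉)) z≤n
    ... | yes u∈ = subst (_≤ leave x u) (sym (mem-∈ (y , z , w) (y≢z , y≢w , z≢w) u∈))
                     (≤-reflexive (sym (on u∈)))
      where
      on : u ∈B (y , z , w) → leave x u ≡ 1
      on (inj₁ refl)        = leave-edge xy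
      on (inj₂ (inj₁ refl)) = leave-edge xz
      on (inj₂ (inj₂ refl)) = leave-edge xw

  LeaveEdge-sym : ∀ {x y} → LeaveEdge bs x y → LeaveEdge bs y x
  LeaveEdge-sym (x≢y , none) = x≢y ∘ sym , λ i → λ (p , q) → none i (q , p)

  -- Every degree is even, so a and b have degree at least 4, and each of the
  -- at least four neighbours of a has degree at least 2.
  leave-odd : ∀ m → n ≡ 2 * m + 1 → LeaveHasK4e bs → 14 ≤ sum leaveDegree
  leave-odd m n≡ (a , b , c , d , a≢b , a≢c , a≢d , b≢c , b≢d , c≢d , ab , ac , ad , bc , bd) = begin
    14
      -- 14 = 2·4 + 4 + 2: each neighbour of `a` is charged 2, `a` itself 4, and `b`, already
      -- charged 2 as a neighbour, 2 more to reach degree 4.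
      ≤⟨ +-monoˡ-≤ 2 (+-monoˡ-≤ 4 (*-monoʳ-≤ 2 degree-a)) ⟩
    2 * leaveDegree a + 4 + 2
      ≡⟨ cong₂ _+_ (cong₂ _+_ (sym (*-distribˡ-sum 2 (leave a))) (sum-scale 4 a)) (sum-scale 2 b) ⟨
    sum (λ x → 2 * leave a x) + sum (λ x → 4 * δ x a) + sum (λ x → 2 * δ x b)
      ≡⟨ cong (_+ sum (λ x → 2 * δ x b)) (∑-distrib-+ (λ x → 2 * leave a x) (λ x → 4 * δ x a)) ⟨
    sum (λ x → 2 * leave a x + 4 * δ x a) + sum (λ x → 2 * δ x b)
      ≡⟨ ∑-distrib-+ (λ x → 2 * leave a x + 4 * δ x a) (λ x → 2 * δ x b) ⟨
    sum (λ x → 2 * leave a x + 4 * δ x a + 2 * δ x b)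
      ≤⟨ sum-mono pointwise ⟩
    sum leaveDegree ∎
    where
    open ≤-Reasoning
    parity : ∀ x → leaveDegree x + 2 * replication x ≡ 2 * m
    parity x = +-cancelʳ-≡ 1 _ _ (trans (degree-identity x) n≡)

    degree-a : 4 ≤ leaveDegree a
    degree-a = even-round-up 1 {r = replication a} {m} (parity a) (neighbours-3 b≢c b≢d c≢d ab ac ad)

    degree-b : 4 ≤ leaveDegree b
    degree-b = even-round-up 1 {r = replication b} {m} (parity b) (neighbours-3 a≢c a≢d c≢d (LeaveEdge-sym ab) bc bd)

    sum-scale : ∀ k (v : Fin n) → sum (λ x → k * δ x v) ≡ k
    sum-scale k v = trans (sym (*-distribˡ-sum k (λ x → δ x v)))
                      (trans (cong (k *_) (sum-δ v)) (*-identityʳ k))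

    neighbour : ∀ x → 2 * leave a x ≤ leaveDegree x
    neighbour x with leave a x in eq
    ... | zero = z≤n
    ... | suc zero = even-round-up 0 {r = replication x} {m} (parity x)
      (≤-trans (≤-reflexive (sym (trans (leave-sym x a) eq))) (term≤sum (leave x) a))
    ... | suc (suc _) with s≤s () ← subst (_≤ 1) eq (leave≤1 a x)

    pointwise : ∀ x → 2 * leave a x + 4 * δ x a + 2 * δ x b ≤ leaveDegree x
    pointwise x with x ≟ a
    ... | yes refl rewrite leave-diagonal a | δ-≢ a≢b = degree-a
    ... | no _ with x ≟ b
    ...   | yes refl rewrite leave-edge ab = degree-b
    ...   | no _ rewrite +-identityʳ (2 * leave a x + 0) | +-identityʳ (2 * leave a x) = neighbour x

  -- Every degree is odd, so every point has degree at least 1, and a, b, c, d at least 3.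
  leave-even : ∀ m → n ≡ 2 * m → LeaveHasK4e bs → n + 8 ≤ sum leaveDegree
  leave-even m n≡ (a , b , c , d , a≢b , a≢c , a≢d , b≢c , b≢d , c≢d , ab , ac , ad , bc , bd) = begin
    n + 8
      ≡⟨ cong₂ _+_ (trans (sum-const n 1) (*-identityʳ n))
           (trans (sym (*-distribˡ-sum 2 on)) (cong (2 *_) sum-on)) ⟨
    sum {n} (λ _ → 1) + sum (λ x → 2 * on x)
      ≡⟨ ∑-distrib-+ (λ _ → 1) (λ x → 2 * on x) ⟨
    sum (λ x → 1 + 2 * on x)
      ≤⟨ sum-mono pointwise ⟩
    sum leaveDegree ∎
    where
    open ≤-Reasoning
    on : Fin n → ℕ
    on x = mem x (a , b , c) + δ x d

    sum-on : sum on ≡ 4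
    sum-on = trans (∑-distrib-+ (λ x → mem x (a , b , c)) (λ x → δ x d))
                   (cong₂ _+_ (sum-mem (a , b , c)) (sum-δ d))

    parity : ∀ x → suc (leaveDegree x) + 2 * replication x ≡ 2 * m
    parity x = trans (sym (+-comm _ 1)) (trans (degree-identity x) n≡)

    -- Since `suc (leaveDegree x)` is even, the even rounding applies to it, one step higher.
    odd-round-up : ∀ k x → 2 * k ≤ leaveDegree x → suc (2 * k) ≤ leaveDegree x
    odd-round-up k x k≤ = ≤-trans (≤-reflexive (sym (+-suc k (k + 0))))
      (≤-pred (even-round-up k {r = replication x} {m} (parity x) (s≤s k≤)))

    pointwise : ∀ x → 1 + 2 * on x ≤ leaveDegree x
    pointwise x with x ∈B? (a , b , c)
    ... | yes x∈ = subst (λ u → 1 + 2 * u ≤ leaveDegree x)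
      (sym (cong₂ _+_ (mem-∈ (a , b , c) (a≢b , a≢c , b≢c) x∈) (δ-≢ (x≢d x∈))))
      (odd-round-up 1 x (two x∈))
      where
      x≢d : ∀ {x} → x ∈B (a , b , c) → x ≢ d
      x≢d (inj₁ refl)        = a≢d
      x≢d (inj₂ (inj₁ refl)) = b≢d
      x≢d (inj₂ (inj₂ refl)) = c≢d
      -- Two known neighbours do at every vertex, as oddness turns 2 into 3; so `a` and `b` are
      -- treated like `c` and `d`.
      two : ∀ {x} → x ∈B (a , b , c) → 2 ≤ leaveDegree x
      two (inj₁ refl)        = neighbours-2 c≢d ac ad
      two (inj₂ (inj₁ refl)) = neighbours-2 c≢d bc bd
      two (inj₂ (inj₂ refl)) = neighbours-2 a≢b (LeaveEdge-sym ac) (LeaveEdge-sym bc)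
    ... | no x∉ with x ≟ d
    ...   | yes refl = subst (λ u → 1 + 2 * u ≤ leaveDegree x)
      (sym (cong₂ _+_ (mem-∉ (a , b , c) x∉) refl))
      (odd-round-up 1 x (neighbours-2 a≢b (LeaveEdge-sym ad) (LeaveEdge-sym bd)))
    ...   | no _ = subst (λ u → 1 + 2 * u ≤ leaveDegree x)
      (sym (cong₂ _+_ (mem-∉ (a , b , c) x∉) refl))
      (odd-round-up 0 x z≤n)

-- Arithmetic of the upper bound by residue class

choose-2 : ∀ n → 2 * (n C 2) + n ≡ n * n
choose-2 zero    = refl
choose-2 (suc n) = begin
  2 * (suc n C 2) + suc n          ≡⟨ cong (λ u → 2 * u + suc n) (nCk+nC[k+1]≡[n+1]C[k+1] n 1) ⟨
  2 * (n C 1 + n C 2) + suc n      ≡⟨ cong (λ u → 2 * (u + n C 2) + suc n) (nC1≡n n) ⟩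
  2 * (n + n C 2) + suc n          ≡⟨ regroup n (n C 2) ⟩
  (2 * (n C 2) + n) + (2 * n + 1)  ≡⟨ cong (_+ (2 * n + 1)) (choose-2 n) ⟩
  n * n + (2 * n + 1)              ≡⟨ square n ⟩
  suc n * suc n                    ∎
  where
  open ≡-Reasoning
  regroup : ∀ n c → 2 * (n + c) + suc n ≡ (2 * c + n) + (2 * n + 1)
  regroup = solve-∀
  square : ∀ n → n * n + (2 * n + 1) ≡ suc n * suc n
  square = solve-∀

choose-2-unique : ∀ n c → 2 * c + n ≡ n * n → n C 2 ≡ c
choose-2-unique n c eq = *-cancelˡ-≡ (n C 2) c 2 (+-cancelʳ-≡ n _ _ (trans (choose-2 n) (sym eq)))

f-residue : ∀ r t → f (r + t * 6) ≡ fAux (r + t * 6) (r % 6)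
f-residue r t = cong (fAux (r + t * 6)) ([m+kn]%n≡m%n r t 6)

halve : ∀ {n} m → n ≡ m * 2 → n / 2 ≡ m
halve m n≡ = trans (cong (_/ 2) n≡) (m*n/n≡m m 2)

f-0 : ∀ t → f (0 + t * 6) ≡ 3 * t + 6
f-0 t = trans (f-residue 0 t) (cong (_+ 6) (halve (3 * t) (double t)))
  where double : ∀ t → t * 6 ≡ 3 * t * 2
        double = solve-∀

f-2 : ∀ t → f (2 + t * 6) ≡ 3 * t + 7
f-2 t = trans (f-residue 2 t) (trans (cong (_+ 6) (halve (3 * t + 1) (double t))) (+-assoc (3 * t) 1 6))
  where double : ∀ t → 2 + t * 6 ≡ (3 * t + 1) * 2
        double = solve-∀

f-4 : ∀ t → f (4 + t * 6) ≡ 3 * t + 6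
f-4 t = trans (f-residue 4 t) (trans (cong (_+ 4) (halve (3 * t + 2) (double t))) (+-assoc (3 * t) 2 4))
  where double : ∀ t → 4 + t * 6 ≡ (3 * t + 2) * 2
        double = solve-∀

-- Scaled by 3, with `f n` on the side of the blocks: no division occurs, and when `Upper` and
-- `Lower` meet, the divisibility by 3 comes out as well.
Upper : ℕ → Set
Upper n = (bs : List (Triple n)) → IsPacking n bs → LeaveHasK4e bs → 3 * length bs + f n ≤ n C 2

Lower : ℕ → Set
Lower n = ∃[ bs ] (IsPacking n bs × LeaveHasK4e bs × n C 2 ≤ 3 * length bs + f n)

upper∧lower : ∀ {n} → Upper n → Lower n → ∃[ k ] (IsMK4e n k × 3 * k + f n ≡ n C 2)
upper∧lower {n} upper (bs , packing , k4e , large) =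
  length bs , ((bs , packing , k4e , refl) , maximal) , exact
  where
  exact : 3 * length bs + f n ≡ n C 2
  exact = ≤-antisym (upper bs packing k4e) large
  maximal : (cs : List (Triple n)) → IsPacking n cs → LeaveHasK4e cs → length cs ≤ length bs
  maximal cs p q = *-cancelˡ-≤ 3 (+-cancelʳ-≤ (f n) _ _ (≤-trans (upper cs p q) large))

module _ {n : ℕ} (bs : List (Triple n)) (packing : IsPacking n bs) where
  open Counting bs packing

  edges-blocks : sum leaveDegree + 6 * length bs ≡ 2 * (n C 2)
  edges-blocks = +-cancelʳ-≡ n _ _ (trans total-identity (sym (choose-2 n)))

  large-leave : ∀ k → k ≤ sum leaveDegree → k + 6 * length bs ≤ 2 * (n C 2)
  large-leave k k≤ = ≤-trans (+-monoˡ-≤ (6 * length bs) k≤) (≤-reflexive edges-blocks)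

-- The congruence argument: multiples of 6 that differ by at least 2 differ by at least 6. This
-- lifts a degree bound to the next value that a number of blocks allows.
round-up : ∀ B M → 6 * B + 2 ≤ 6 * M → B < M
round-up B M le = *-cancelˡ-< 6 B M (≤-trans (≤-trans (≤-reflexive (+-comm 1 (6 * B))) (+-monoʳ-≤ (6 * B) (s≤s z≤n))) le)

upper-0 : ∀ t → Upper (0 + t * 6)
-- Here n C 2 = 18t² - 3t; adding 3t to both sides removes the subtraction and leaves a multiple of
-- 3.
upper-0 t bs packing k4e rewrite f-0 t = +-cancelʳ-≤ (3 * t) _ _ (begin
  3 * B + (3 * t + 6) + 3 * t   ≡⟨ e₁ B t ⟩
  3 * suc (B + 2 * t + 1)       ≤⟨ *-monoʳ-≤ 3 (round-up (B + 2 * t + 1) (6 * t * t) (begin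
    6 * (B + 2 * t + 1) + 2        ≡⟨ e₂ B t ⟩
    t * 6 + 8 + 6 * B + t * 6      ≤⟨ +-monoˡ-≤ (t * 6) (large-leave bs packing (t * 6 + 8)
                                       (LeaveBounds.leave-even bs packing (3 * t) (e₃ t) k4e)) ⟩
    2 * (t * 6 C 2) + t * 6        ≡⟨ choose-2 (t * 6) ⟩
    t * 6 * (t * 6)                ≡⟨ e₄ t ⟩
    6 * (6 * t * t)                ∎)) ⟩
  3 * (6 * t * t)               ≡⟨ *-cancelˡ-≡ _ _ 2 (trans (e₅ t) (trans (sym (choose-2 (t * 6))) (e₆ (t * 6 C 2) t))) ⟩
  t * 6 C 2 + 3 * t             ∎)
  where
  open ≤-Reasoning
  B = length bs
  e₁ : ∀ B t → 3 * B + (3 * t + 6) + 3 * t ≡ 3 * suc (B + 2 * t + 1)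
  e₁ = solve-∀
  e₂ : ∀ B t → 6 * (B + 2 * t + 1) + 2 ≡ t * 6 + 8 + 6 * B + t * 6
  e₂ = solve-∀
  e₃ : ∀ t → t * 6 ≡ 2 * (3 * t)
  e₃ = solve-∀
  e₄ : ∀ t → t * 6 * (t * 6) ≡ 6 * (6 * t * t)
  e₄ = solve-∀
  e₅ : ∀ t → 2 * (3 * (6 * t * t)) ≡ t * 6 * (t * 6)
  e₅ = solve-∀
  e₆ : ∀ c t → 2 * c + t * 6 ≡ 2 * (c + 3 * t)
  e₆ = solve-∀

upper-2 : ∀ t → Upper (2 + t * 6)
upper-2 t bs packing k4e rewrite f-2 t = begin
  3 * B + (3 * t + 7)           ≡⟨ e₁ B t ⟩
  -- Now n C 2 = 3M + 1 with M = 6t² + 3t; the surplus 1, doubled to 2, is cancelled before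
  -- rounding.
  3 * suc (B + t + 1) + 1       ≤⟨ +-monoˡ-≤ 1 (*-monoʳ-≤ 3 (round-up (B + t + 1) (6 * t * t + 3 * t) (+-cancelʳ-≤ 2 _ _ (begin
    6 * (B + t + 1) + 2 + 2        ≡⟨ e₂ B t ⟩
    2 + t * 6 + 8 + 6 * B          ≤⟨ large-leave bs packing (2 + t * 6 + 8)
                                       (LeaveBounds.leave-even bs packing (3 * t + 1) (e₃ t) k4e) ⟩
    2 * ((2 + t * 6) C 2)          ≡⟨ cong (2 *_) choose ⟩
    2 * c                          ≡⟨ e₅ t ⟩
    6 * (6 * t * t + 3 * t) + 2    ∎)))) ⟩
  3 * (6 * t * t + 3 * t) + 1   ≡⟨ choose ⟨
  (2 + t * 6) C 2               ∎
  where
  open ≤-Reasoning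
  B = length bs
  c = 3 * (6 * t * t + 3 * t) + 1
  e₁ : ∀ B t → 3 * B + (3 * t + 7) ≡ 3 * suc (B + t + 1) + 1
  e₁ = solve-∀
  e₂ : ∀ B t → 6 * (B + t + 1) + 2 + 2 ≡ 2 + t * 6 + 8 + 6 * B
  e₂ = solve-∀
  e₃ : ∀ t → 2 + t * 6 ≡ 2 * (3 * t + 1)
  e₃ = solve-∀
  e₄ : ∀ t → 2 * (3 * (6 * t * t + 3 * t) + 1) + (2 + t * 6) ≡ (2 + t * 6) * (2 + t * 6)
  e₄ = solve-∀
  e₅ : ∀ t → 2 * (3 * (6 * t * t + 3 * t) + 1) ≡ 6 * (6 * t * t + 3 * t) + 2
  e₅ = solve-∀
  choose : (2 + t * 6) C 2 ≡ c
  choose = choose-2-unique (2 + t * 6) c (e₄ t)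

upper-4 : ∀ t → Upper (4 + t * 6)
upper-4 t bs packing k4e rewrite f-4 t = *-cancelˡ-≤ 2 (begin
  -- The degree bound n + 8 already equals 2 · f n in this class.
  2 * (3 * B + (3 * t + 6))      ≡⟨ e₁ B t ⟩
  4 + t * 6 + 8 + 6 * B          ≤⟨ large-leave bs packing (4 + t * 6 + 8)
                                     (LeaveBounds.leave-even bs packing (3 * t + 2) (e₂ t) k4e) ⟩
  2 * ((4 + t * 6) C 2)          ∎)
  where
  open ≤-Reasoning
  B = length bs
  e₁ : ∀ B t → 2 * (3 * B + (3 * t + 6)) ≡ 4 + t * 6 + 8 + 6 * B
  e₁ = solve-∀
  e₂ : ∀ t → 4 + t * 6 ≡ 2 * (3 * t + 2)
  e₂ = solve-∀

upper-5 : ∀ t → Upper (5 + t * 6)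
upper-5 t bs packing k4e rewrite f-residue 5 t = *-cancelˡ-≤ 2 (begin
  2 * (3 * B + 7)                ≡⟨ e₁ B ⟩
  14 + 6 * B                     ≤⟨ large-leave bs packing 14
                                     (LeaveBounds.leave-odd bs packing (3 * t + 2) (e₂ t) k4e) ⟩
  2 * ((5 + t * 6) C 2)          ∎)
  where
  open ≤-Reasoning
  B = length bs
  e₁ : ∀ B → 2 * (3 * B + 7) ≡ 14 + 6 * B
  e₁ = solve-∀
  e₂ : ∀ t → 5 + t * 6 ≡ 2 * (3 * t + 2) + 1
  e₂ = solve-∀

-- With n C 2 divisible by 3, the number of leave edges is too, so the bound 14 on the degree sum
-- rises to 18.
upper-steiner : ∀ {n} m M → n ≡ 2 * m + 1 → n C 2 ≡ 3 * M → f n ≡ 9 → Upper n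
upper-steiner {n} m M n≡ choose f≡ bs packing k4e = begin
  3 * B + f n          ≡⟨ cong (3 * B +_) f≡ ⟩
  3 * B + 9            ≡⟨ e₁ B ⟩
  3 * suc (B + 2)      ≤⟨ *-monoʳ-≤ 3 (round-up (B + 2) M (begin
    6 * (B + 2) + 2      ≡⟨ e₂ B ⟩
    14 + 6 * B           ≤⟨ large-leave bs packing 14 (LeaveBounds.leave-odd bs packing m n≡ k4e) ⟩
    2 * (n C 2)          ≡⟨ cong (2 *_) choose ⟩
    2 * (3 * M)          ≡⟨ *-assoc 2 3 M ⟨
    6 * M                ∎)) ⟩
  3 * M                ≡⟨ choose ⟨
  n C 2                ∎
  where
  open ≤-Reasoning
  B = length bs
  e₁ : ∀ B → 3 * B + 9 ≡ 3 * suc (B + 2)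
  e₁ = solve-∀
  e₂ : ∀ B → 6 * (B + 2) + 2 ≡ 14 + 6 * B
  e₂ = solve-∀

upper-1 : ∀ t → Upper (1 + t * 6)
upper-1 t = upper-steiner (3 * t) (t * (6 * t + 1)) (e₁ t)
  (choose-2-unique (1 + t * 6) (3 * (t * (6 * t + 1))) (e₂ t)) (f-residue 1 t)
  where
  e₁ : ∀ t → 1 + t * 6 ≡ 2 * (3 * t) + 1
  e₁ = solve-∀
  e₂ : ∀ t → 2 * (3 * (t * (6 * t + 1))) + (1 + t * 6) ≡ (1 + t * 6) * (1 + t * 6)
  e₂ = solve-∀

upper-3 : ∀ t → Upper (3 + t * 6)
upper-3 t = upper-steiner (3 * t + 1) ((2 * t + 1) * (3 * t + 1)) (e₁ t)
  (choose-2-unique (3 + t * 6) (3 * ((2 * t + 1) * (3 * t + 1))) (e₂ t)) (f-residue 3 t)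
  where
  e₁ : ∀ t → 3 + t * 6 ≡ 2 * (3 * t + 1) + 1
  e₁ = solve-∀
  e₂ : ∀ t → 2 * (3 * ((2 * t + 1) * (3 * t + 1))) + (3 + t * 6) ≡ (3 + t * 6) * (3 + t * 6)
  e₂ = solve-∀

-- From partial triple systems to packings

just≢nothing : ∀ {A : Set} {x : A} {m : Maybe A} → m ≡ just x → m ≢ nothing
just≢nothing refl ()

-- third x y is the third point of the block through x and y, if there is one.
record PartialTripleSystem (A : Set) : Set where
  field
    third  : A → A → Maybe A
    irrefl : ∀ x → third x x ≡ nothing
    comm   : ∀ x y → third x y ≡ third y x
    swap   : ∀ {x y z} → third x y ≡ just z → third x z ≡ just y

  rotate : ∀ {x y z} → third x y ≡ just z → third y z ≡ just x
  rotate {x} {y} xyz = swap (trans (comm y x) xyz)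

  distinct : ∀ {x y z} → third x y ≡ just z → x ≢ y
  distinct xyz refl = just≢nothing xyz (irrefl _)

module PTS = PartialTripleSystem

-- The packing condition by membership instead of position, which passes easily through filtering
-- and consing; `unique` recovers the statement about positions.
record Linear {n} (bs : List (Triple n)) : Set where
  field
    unique : Unique bs
    block  : ∀ {B} → B ∈ bs → IsBlock B
    linear : ∀ {B B′ x y} → B ∈ bs → B′ ∈ bs → x ≢ y → PairIn x y B → PairIn x y B′ → B ≡ B′

lookup-injective : ∀ {A : Set} {xs : List A} → Unique xs → ∀ i j → lookup xs i ≡ lookup xs j → i ≡ j
lookup-injective (_ ∷ _)    zero    zero    _  = refl
lookup-injective (x∉ ∷ _)   zero    (suc j) eq = ⊥-elim (All.lookup x∉ (∈-lookup j) eq)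
lookup-injective (x∉ ∷ _)   (suc i) zero    eq = ⊥-elim (All.lookup x∉ (∈-lookup i) (sym eq))
lookup-injective (_ ∷ uniq) (suc i) (suc j) eq = cong suc (lookup-injective uniq i j eq)

Linear⇒IsPacking : ∀ {n} {bs : List (Triple n)} → Linear bs → IsPacking n bs
Linear⇒IsPacking {bs = bs} lin =
  (λ i → block (∈-lookup i)) ,
  (λ x y x≢y i j p q → lookup-injective unique i j (linear (∈-lookup i) (∈-lookup j) x≢y p q))
  where open Linear lin

leaveEdge : ∀ {n} {bs : List (Triple n)} {x y} → x ≢ y → (∀ {B} → B ∈ bs → ¬ PairIn x y B) → LeaveEdge bs x y
leaveEdge x≢y none = x≢y , λ i → none (∈-lookup i)

remove : ∀ {n} → Fin n → Fin n → List (Triple n) → List (Triple n)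
remove x y = filter (¬? ∘ PairIn? x y)

module _ {n} {x y : Fin n} {bs : List (Triple n)} where

  remove-⊆ : ∀ {B} → B ∈ remove x y bs → B ∈ bs
  remove-⊆ B∈ = proj₁ (∈-filter⁻ (¬? ∘ PairIn? x y) B∈)

  remove-avoids : ∀ {B} → B ∈ remove x y bs → ¬ PairIn x y B
  remove-avoids B∈ = proj₂ (∈-filter⁻ (¬? ∘ PairIn? x y) {xs = bs} B∈)

  remove-linear : Linear bs → Linear (remove x y bs)
  remove-linear lin = record
    { unique = Unique.filter⁺ (¬? ∘ PairIn? x y) unique
    ; block  = block ∘ remove-⊆
    ; linear = λ p q → linear (remove-⊆ p) (remove-⊆ q)
    }
    where open Linear lin

-- The loss is written as a sum of brackets so that it matches `covered≡`: removing the blocks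
-- through a pair costs `covered` blocks.
length-filter-¬ : ∀ {A : Set} {Q : A → Set} (Q? : Decidable Q) xs →
  length xs ≤ length (filter (¬? ∘ Q?) xs) + sum (λ i → ⟦ Q? (lookup xs i) ⟧)
length-filter-¬ Q? []       = z≤n
length-filter-¬ Q? (x ∷ xs) with Q? x
... | yes _ = ≤-trans (s≤s (length-filter-¬ Q? xs)) (≤-reflexive (sym (+-suc _ _)))
... | no  _ = s≤s (length-filter-¬ Q? xs)

module _ {n} {bs : List (Triple n)} (lin : Linear bs) where
  open Counting bs (Linear⇒IsPacking lin)

  length-remove-covered : ∀ x y → length bs ≤ length (remove x y bs) + covered x y
  length-remove-covered x y = subst (λ c → length bs ≤ length (remove x y bs) + c)
    (sym (covered≡ x y)) (length-filter-¬ (PairIn? x y) bs)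

  length-remove : ∀ {x y} → x ≢ y → length bs ≤ length (remove x y bs) + 1
  length-remove {x} {y} x≢y = ≤-trans (length-remove-covered x y) (+-monoʳ-≤ _ (covered≤1 x≢y))

  length-remove-leave : ∀ {x y} → LeaveEdge bs x y → length bs ≤ length (remove x y bs)
  length-remove-leave {x} {y} (_ , none) = ≤-trans (length-remove-covered x y)
    (≤-reflexive (trans (cong (length (remove x y bs) +_) (covered-0 none)) (+-identityʳ _)))

cons-linear : ∀ {n} {bs : List (Triple n)} T → IsBlock T →
  (∀ {B x y} → B ∈ bs → x ≢ y → PairIn x y T → ¬ PairIn x y B) → Linear bs → Linear (T ∷ bs)
cons-linear {bs = bs} T@(a , b , c) T-block@(a≢b , _) disjoint lin = record
  { unique = All.tabulate (λ {B} B∈ T≡B → disjoint B∈ a≢b abT (subst (PairIn a b) T≡B abT)) ∷ unique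
  ; block  = λ { (here refl) → T-block ; (there B∈) → block B∈ }
  ; linear = λ { (here refl) (here refl) _   _ _ → refl
               ; (here refl) (there q)   x≢y s t → ⊥-elim (disjoint q x≢y s t)
               ; (there p)   (here refl) x≢y s t → ⊥-elim (disjoint p x≢y t s)
               ; (there p)   (there q)           → linear p q }
  }
  where
  open Linear lin
  abT : PairIn a b T
  abT = inj₁ refl , inj₂ (inj₁ refl)

-- The list of blocks of a partial triple system

module Blocks {n} (S : PartialTripleSystem (Fin n)) where
  open PartialTripleSystem S

  -- A block arises from six ordered triples; increasing order selects one of them.
  SortedBlock : Triple n → Set
  SortedBlock (a , b , c) = a Fin.< b × b Fin.< c × third a b ≡ just c

  SortedBlock? : Decidable SortedBlock
  SortedBlock? (a , b , c) = a Fin.<? b ×-dec b Fin.<? c ×-dec Maybe.≡-dec _≟_ (third a b) (just c)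

  triples : List (Triple n)
  triples = cartesianProduct (allFin n) (cartesianProduct (allFin n) (allFin n))

  blocks : List (Triple n)
  blocks = filter SortedBlock? triples

  blocks-sorted : ∀ {B} → B ∈ blocks → SortedBlock B
  blocks-sorted B∈ = proj₂ (∈-filter⁻ SortedBlock? {xs = triples} B∈)

  sorted-blocks : ∀ {B} → SortedBlock B → B ∈ blocks
  sorted-blocks = ∈-filter⁺ SortedBlock?
    (∈-cartesianProduct⁺ (∈-allFin _) (∈-cartesianProduct⁺ (∈-allFin _) (∈-allFin _)))

  Spans : Fin n → Fin n → Fin n → Triple n → Set
  Spans x y z B = third x y ≡ just z × z ∈B B × (∀ {w} → w ∈B B → w ∈B (x , y , z))

  spans : ∀ {x y} B → SortedBlock B → x ≢ y → PairIn x y B → ∃[ z ] Spans x y z B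
  spans (a , b , c) (_ , _ , abc) x≢y = λ
    { (inj₁ refl , inj₁ refl) → ⊥-elim (x≢y refl)
    ; (inj₁ refl , inj₂ (inj₁ refl)) → _ , abc , inj₂ (inj₂ refl) , λ w → w
    ; (inj₁ refl , inj₂ (inj₂ refl)) → _ , swap abc , inj₂ (inj₁ refl) ,
        λ { (inj₁ p) → inj₁ p ; (inj₂ (inj₁ p)) → inj₂ (inj₂ p) ; (inj₂ (inj₂ p)) → inj₂ (inj₁ p) }
    ; (inj₂ (inj₁ refl) , inj₁ refl) → _ , trans (comm b a) abc , inj₂ (inj₂ refl) ,
        λ { (inj₁ p) → inj₂ (inj₁ p) ; (inj₂ (inj₁ p)) → inj₁ p ; (inj₂ (inj₂ p)) → inj₂ (inj₂ p) }
    ; (inj₂ (inj₁ refl) , inj₂ (inj₁ refl)) → ⊥-elim (x≢y refl)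
    ; (inj₂ (inj₁ refl) , inj₂ (inj₂ refl)) → _ , rotate abc , inj₁ refl ,
        λ { (inj₁ p) → inj₂ (inj₂ p) ; (inj₂ (inj₁ p)) → inj₁ p ; (inj₂ (inj₂ p)) → inj₂ (inj₁ p) }
    ; (inj₂ (inj₂ refl) , inj₁ refl) → _ , rotate (rotate abc) , inj₂ (inj₁ refl) ,
        λ { (inj₁ p) → inj₂ (inj₁ p) ; (inj₂ (inj₁ p)) → inj₂ (inj₂ p) ; (inj₂ (inj₂ p)) → inj₁ p }
    ; (inj₂ (inj₂ refl) , inj₂ (inj₁ refl)) → _ , swap (rotate (rotate abc)) , inj₁ refl ,
        λ { (inj₁ p) → inj₂ (inj₂ p) ; (inj₂ (inj₁ p)) → inj₂ (inj₁ p) ; (inj₂ (inj₂ p)) → inj₁ p }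
    ; (inj₂ (inj₂ refl) , inj₂ (inj₂ refl)) → ⊥-elim (x≢y refl)
    }

  pair-third : ∀ {x y B} → B ∈ blocks → x ≢ y → PairIn x y B → ∃[ z ] Spans x y z B
  pair-third {B = B} B∈ = spans B (blocks-sorted B∈)

  -- Both blocks consist of `x`, `y` and the one point `third x y`.
  share-⊆ : ∀ {B B′ x y} → B ∈ blocks → B′ ∈ blocks → x ≢ y → PairIn x y B → PairIn x y B′ →
            ∀ {w} → w ∈B B → w ∈B B′
  share-⊆ {x = x} {y} B∈ B′∈ x≢y xyB xyB′ w∈ with pair-third B∈ x≢y xyB | pair-third B′∈ x≢y xyB′
  ... | z , xyz , _ , ⊆xyz | z′ , xyz′ , z′∈ , _ with refl ← trans (sym xyz) xyz′ with ⊆xyz w∈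
  ...   | inj₁ refl        = proj₁ xyB′
  ...   | inj₂ (inj₁ refl) = proj₂ xyB′
  ...   | inj₂ (inj₂ refl) = z′∈

  least : ∀ {a b c x} → SortedBlock (a , b , c) → x ∈B (a , b , c) → a Fin.≤ x
  least _                 (inj₁ refl)        = ≤-refl
  least (a<b , _ , _)     (inj₂ (inj₁ refl)) = <⇒≤ a<b
  least (a<b , b<c , _)   (inj₂ (inj₂ refl)) = <⇒≤ (<-trans a<b b<c)

  greatest : ∀ {a b c x} → SortedBlock (a , b , c) → x ∈B (a , b , c) → x Fin.≤ c
  greatest (a<b , b<c , _) (inj₁ refl)        = <⇒≤ (<-trans a<b b<c)
  greatest (_ , b<c , _)   (inj₂ (inj₁ refl)) = <⇒≤ b<c
  greatest _               (inj₂ (inj₂ refl)) = ≤-refl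

  blocks-linear : Linear blocks
  blocks-linear = record
    { unique = Unique.filter⁺ SortedBlock?
        (Unique.cartesianProduct⁺ (Unique.allFin⁺ n) (Unique.cartesianProduct⁺ (Unique.allFin⁺ n) (Unique.allFin⁺ n)))
    ; block  = λ {B} B∈ → let (_ , _ , abc) = blocks-sorted B∈ in
        distinct abc , distinct (swap abc) , distinct (rotate abc)
    ; linear = same
    }
    where
    same : ∀ {B B′ x y} → B ∈ blocks → B′ ∈ blocks → x ≢ y → PairIn x y B → PairIn x y B′ → B ≡ B′
    same {a , b , c} {a′ , b′ , c′} B∈ B′∈ x≢y p q
      -- Equal point sets have equal least and greatest entries, and `third` of these two is the
      -- middle one.
      with refl ← Fin.≤-antisym (least (blocks-sorted B∈) (share-⊆ B′∈ B∈ x≢y q p (inj₁ refl)))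
                                (least (blocks-sorted B′∈) (share-⊆ B∈ B′∈ x≢y p q (inj₁ refl)))
         | refl ← Fin.≤-antisym (greatest (blocks-sorted B′∈) (share-⊆ B∈ B′∈ x≢y p q (inj₂ (inj₂ refl))))
                                (greatest (blocks-sorted B∈) (share-⊆ B′∈ B∈ x≢y q p (inj₂ (inj₂ refl))))
      with refl ← Maybe.just-injective (trans (sym (swap (proj₂ (proj₂ (blocks-sorted B∈)))))
                                        (swap (proj₂ (proj₂ (blocks-sorted B′∈))))) = refl

  third-block : ∀ {x y z} → third x y ≡ just z → ∃[ B ] (B ∈ blocks × PairIn x y B)
  third-block {x} {y} xyz = case Fin.<-cmp x y of λ
    { (tri< x<y _ _) → ascending x<y xyz
    ; (tri≈ _ x≡y _) → ⊥-elim (distinct xyz x≡y)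
    ; (tri> _ _ y<x) → let (B , B∈ , p , q) = ascending y<x (trans (comm y x) xyz) in B , B∈ , q , p
    }
    where
    ascending : ∀ {x y z} → x Fin.< y → third x y ≡ just z → ∃[ B ] (B ∈ blocks × PairIn x y B)
    ascending {x} {y} {z} x<y xyz with Fin.<-cmp y z
    ... | tri< y<z _ _ = (x , y , z) , sorted-blocks (x<y , y<z , xyz) , inj₁ refl , inj₂ (inj₁ refl)
    ... | tri≈ _ y≡z _ = ⊥-elim (distinct (rotate xyz) y≡z)
    ... | tri> _ _ z<y with Fin.<-cmp x z
    ...   | tri< x<z _ _ = (x , z , y) , sorted-blocks (x<z , z<y , swap xyz) , inj₁ refl , inj₂ (inj₂ refl)
    ...   | tri≈ _ x≡z _ = ⊥-elim (distinct (swap xyz) x≡z)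
    ...   | tri> _ _ z<x = (z , x , y) , sorted-blocks (z<x , x<y , rotate (rotate xyz)) ,
                           inj₂ (inj₁ refl) , inj₂ (inj₂ refl)

  nothing-leaveEdge : ∀ {x y} → x ≢ y → third x y ≡ nothing → LeaveEdge blocks x y
  nothing-leaveEdge x≢y none = leaveEdge x≢y λ B∈ xy∈ →
    just≢nothing (proj₁ (proj₂ (pair-third B∈ x≢y xy∈))) none

  blocks-packing : IsPacking n blocks
  blocks-packing = Linear⇒IsPacking blocks-linear

  open Counting blocks blocks-packing public using (leave; leaveDegree; leave≤1; leave-diagonal)
  open Counting blocks blocks-packing using (leave-covered)

  third-leave : ∀ {x y z} → third x y ≡ just z → leave x y ≡ 0
  third-leave {x} {y} xyz with third-block xyz
  ... | B , B∈ , xy∈ = leave-covered (index B∈) (subst (PairIn x y) (lookup-index B∈) xy∈)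

  -- Removing the block {a, b, c} frees three of the edges of K₄ − e at once, so the blocks
  -- through ab, ad and bd are enough.
  removeThree : Fin n → Fin n → Fin n → List (Triple n)
  removeThree a b d = remove b d (remove a b (remove a d blocks))

  removeThree-K4e : ∀ {a b c d} → third a b ≡ just c → a ≢ d → b ≢ d → c ≢ d → LeaveHasK4e (removeThree a b d)
  removeThree-K4e {a} {b} {c} {d} abc a≢d b≢d c≢d =
    a , b , c , d , distinct abc , distinct (swap abc) , a≢d , distinct (rotate abc) , b≢d , c≢d ,
    leaveEdge (distinct abc) (avoids-ab ∘ remove-⊆) ,
    -- A surviving block through `a` and `c` would contain `third a c`, which is `b`, and so the
    -- removed pair ab. The edge bc is treated in the same way.
    leaveEdge (distinct (swap abc)) (λ B∈ ac∈ → avoids-ab (remove-⊆ B∈)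
      (proj₁ ac∈ , completes (inside B∈) (distinct (swap abc)) ac∈ (swap abc))) ,
    leaveEdge a≢d (remove-avoids {bs = blocks} ∘ remove-⊆ {bs = remove a d blocks} ∘ remove-⊆) ,
    leaveEdge (distinct (rotate abc)) (λ B∈ bc∈ → avoids-ab (remove-⊆ B∈)
      (completes (inside B∈) (distinct (rotate abc)) bc∈ (rotate abc) , proj₁ bc∈)) ,
    leaveEdge b≢d (remove-avoids {bs = remove a b (remove a d blocks)})
    where
    avoids-ab : ∀ {B} → B ∈ remove a b (remove a d blocks) → ¬ PairIn a b B
    avoids-ab = remove-avoids {bs = remove a d blocks}
    inside : ∀ {B} → B ∈ removeThree a b d → B ∈ blocks
    inside = remove-⊆ {bs = blocks} ∘ remove-⊆ {bs = remove a d blocks} ∘ remove-⊆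
    completes : ∀ {B x y z} → B ∈ blocks → x ≢ y → PairIn x y B → third x y ≡ just z → z ∈B B
    completes B∈ x≢y xy∈ xyz with pair-third B∈ x≢y xy∈
    ... | z′ , xyz′ , z′∈ , _ with refl ← trans (sym xyz) xyz′ = z′∈

  removeThree-linear : ∀ a b d → Linear (removeThree a b d)
  removeThree-linear a b d = remove-linear (remove-linear (remove-linear blocks-linear))

  -- Starts after the removal at `a d`, whose cost depends on the caller: one block in a Steiner
  -- system, none when ad is already in the leave.
  removeThree-length : ∀ {a b d} → a ≢ b → b ≢ d →
    length (remove a d blocks) ≤ length (removeThree a b d) + 2
  removeThree-length {a} {b} {d} a≢b b≢d = ≤-trans
    (≤-trans (length-remove (remove-linear blocks-linear) a≢b)
      (+-monoˡ-≤ 1 (length-remove (remove-linear (remove-linear blocks-linear)) b≢d)))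
    (≤-reflexive (+-assoc (length (removeThree a b d)) 1 1))

-- The size of the leave: holes and deleted points

Steiner : ∀ {A} → PartialTripleSystem A → Set
Steiner S = ∀ {x y} → x ≢ y → ∃[ z ] PTS.third S x y ≡ just z

-- Apart from the excess pairs, the leave lies inside the clique on the image of e.
module Holed {n s} (S : PartialTripleSystem (Fin n)) (e : Fin s → Fin n) (excess : Fin n → Fin n → ℕ)
  (cover : ∀ {x y} → x ≢ y → PTS.third S x y ≡ nothing →
           ((∃[ i ] x ≡ e i) × (∃[ j ] y ≡ e j)) ⊎ 1 ≤ excess x y) where
  open Blocks S

  hole : Fin n → ℕ
  hole x = sum (λ j → δ x (e j))

  hole≥1 : ∀ j → 1 ≤ hole (e j)
  hole≥1 j = ≤-trans (≤-reflexive (sym (δ-refl (e j)))) (term≤sum (λ i → δ (e j) (e i)) j)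

  sum-hole : sum hole ≡ s
  sum-hole = trans (∑-comm (λ x j → δ x (e j)))
    (trans (sum-cong-≗ (sum-δ ∘ e)) (trans (sum-const s 1) (*-identityʳ s)))

  n≤n² : ∀ n → n ≤ n * n
  n≤n² zero    = z≤n
  n≤n² (suc n) = m≤m+n (suc n) (n * suc n)

  -- Off the diagonal an uncovered pair lies in the hole or is an excess pair. On the diagonal the
  -- leave is 0 and `hole x` is at most its square; discounting these loops makes the clique
  -- contribute s² - s instead of s².
  leave-pointwise : ∀ x y → leave x y + δ y x * hole x ≤ hole x * hole y + excess x y
  leave-pointwise x y with y ≟ x
  ... | yes refl rewrite leave-diagonal x | +-identityʳ (hole x) = ≤-trans (n≤n² (hole x)) (m≤m+n _ _)
  ... | no y≢x rewrite +-identityʳ (leave x y) with PTS.third S x y in eq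
  ...   | just z = subst (_≤ hole x * hole y + excess x y) (sym (third-leave eq)) z≤n
  ...   | nothing with cover (y≢x ∘ sym) eq
  ...     | inj₁ ((i , refl) , (j , refl)) =
              ≤-trans (leave≤1 x y) (≤-trans (*-mono-≤ (hole≥1 i) (hole≥1 j)) (m≤m+n _ _))
  ...     | inj₂ 1≤ = ≤-trans (leave≤1 x y) (≤-trans 1≤ (m≤n+m _ _))

  leave-bound : sum leaveDegree + s ≤ s * s + sum (λ x → sum (excess x))
  leave-bound = begin
    sum leaveDegree + s
      ≡⟨ cong (sum leaveDegree +_) sum-hole ⟨
    sum leaveDegree + sum hole
      ≡⟨ ∑-distrib-+ leaveDegree hole ⟨
    sum (λ x → leaveDegree x + hole x)
      ≡⟨ sum-cong-≗ row-left ⟨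
    sum (λ x → sum (λ y → leave x y + δ y x * hole x))
      ≤⟨ sum-mono (λ x → sum-mono (leave-pointwise x)) ⟩
    sum (λ x → sum (λ y → hole x * hole y + excess x y))
      ≡⟨ sum-cong-≗ row-right ⟩
    sum (λ x → hole x * s + sum (excess x))
      ≡⟨ ∑-distrib-+ (λ x → hole x * s) (λ x → sum (excess x)) ⟩
    sum (λ x → hole x * s) + sum (λ x → sum (excess x))
      ≡⟨ cong (_+ sum (λ x → sum (excess x))) (trans (sym (*-distribʳ-sum s hole)) (cong (_* s) sum-hole)) ⟩
    s * s + sum (λ x → sum (excess x)) ∎
    where
    open ≤-Reasoning
    row-left : ∀ x → sum (λ y → leave x y + δ y x * hole x) ≡ leaveDegree x + hole x
    row-left x = trans (∑-distrib-+ (leave x) (λ y → δ y x * hole x)) (cong (leaveDegree x +_)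
      (trans (sym (*-distribʳ-sum (hole x) (λ y → δ y x)))
        (trans (cong (_* hole x) (sum-δ x)) (*-identityˡ (hole x)))))
    row-right : ∀ x → sum (λ y → hole x * hole y + excess x y) ≡ hole x * s + sum (excess x)
    row-right x = trans (∑-distrib-+ (λ y → hole x * hole y) (excess x))
      (cong (_+ sum (excess x)) (trans (sym (*-distribˡ-sum (hole x) hole)) (cong (hole x *_) sum-hole)))

unzero : ∀ {n} → Fin (suc n) → Maybe (Fin n)
unzero zero    = nothing
unzero (suc i) = just i

module Deletion {n} (S : PartialTripleSystem (Fin (suc n))) where
  private module S = PartialTripleSystem S

  third⁻ : Fin n → Fin n → Maybe (Fin n)
  third⁻ x y = S.third (suc x) (suc y) >>= unzero

  third⁻-just : ∀ {x y z} → S.third (suc x) (suc y) ≡ just (suc z) → third⁻ x y ≡ just z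
  third⁻-just eq rewrite eq = refl

  just-third⁻ : ∀ {x y z} → third⁻ x y ≡ just z → S.third (suc x) (suc y) ≡ just (suc z)
  just-third⁻ {x} {y} eq with S.third (suc x) (suc y)
  just-third⁻ refl | just (suc z) = refl

  nothing-third⁻ : ∀ {x y} → third⁻ x y ≡ nothing →
    S.third (suc x) (suc y) ≡ nothing ⊎ S.third zero (suc x) ≡ just (suc y)
  nothing-third⁻ {x} {y} eq with S.third (suc x) (suc y) in xy
  ... | nothing   = inj₁ refl
  ... | just zero = inj₂ (S.rotate (S.rotate xy))

  delete : PartialTripleSystem (Fin n)
  delete = record
    { third  = third⁻
    ; irrefl = λ x → cong (_>>= unzero) (S.irrefl (suc x))
    ; comm   = λ x y → cong (_>>= unzero) (S.comm (suc x) (suc y))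
    ; swap   = λ eq → third⁻-just (S.swap (just-third⁻ eq))
    }

  -- The pairs whose block is destroyed by deleting `zero`; they form a matching.
  matched : Fin n → Fin n → ℕ
  matched x y = ⟦ Maybe.≡-dec _≟_ (S.third zero (suc x)) (just (suc y)) ⟧

  sum-matched : ∀ x → sum (matched x) ≤ 1
  sum-matched x = sum≤1 (matched x) (λ y → ⟦⟧≤1 (m? y))
    (λ y z p q → Fin.suc-injective (Maybe.just-injective
      (trans (sym (⟦⟧-elim (m? y) p)) (⟦⟧-elim (m? z) q))))
    where m? = λ y → Maybe.≡-dec _≟_ (S.third zero (suc x)) (just (suc y))

  module _ {s} (e : Fin s → Fin n) (e-injective : ∀ {i j} → e i ≡ e j → i ≡ j)
    (apart : ∀ j → S.third zero (suc (e j)) ≡ nothing)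
    (cover : ∀ {x y} → x ≢ y → S.third (suc x) (suc y) ≡ nothing → (∃[ i ] x ≡ e i) × (∃[ j ] y ≡ e j)) where

    open Blocks delete using (leaveDegree)

    cover⁻ : ∀ {x y} → x ≢ y → third⁻ x y ≡ nothing →
             ((∃[ i ] x ≡ e i) × (∃[ j ] y ≡ e j)) ⊎ 1 ≤ matched x y
    cover⁻ {x} {y} x≢y eq with nothing-third⁻ eq
    ... | inj₁ xy = inj₁ (cover x≢y xy)
    ... | inj₂ 0x = inj₂ (≤-reflexive (sym (⟦⟧-true (Maybe.≡-dec _≟_ (S.third zero (suc x)) (just (suc y))) 0x)))

    open Holed delete e matched cover⁻ using (hole; sum-hole; leave-bound)

    -- By `apart` a point of the hole shares no block with the deleted point, and injectivity of `e`
    -- counts it once; any other point has at most one partner.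
    matched+hole : ∀ x → sum (matched x) + hole x ≤ 1
    matched+hole x with Fin.any? (λ j → x ≟ e j)
    ... | yes (j , refl) = ≤-trans (≤-reflexive (cong (_+ hole x) (sum-zero λ y →
            ⟦⟧-false (Maybe.≡-dec _≟_ (S.third zero (suc x)) (just (suc y))) (λ eq → just≢nothing eq (apart j)))))
          (sum≤1 _ (λ i → ⟦⟧≤1 (x ≟ e i))
            (λ i k p q → e-injective (trans (sym (⟦⟧-elim (x ≟ e i) p)) (⟦⟧-elim (x ≟ e k) q))))
    ... | no x∉ = ≤-trans (≤-reflexive (trans
            (cong (sum (matched x) +_) (sum-zero λ j → δ-≢ (λ x≡ → x∉ (j , x≡))))
            (+-identityʳ _))) (sum-matched x)

    -- The clique gives s² - s and the matching outside the hole n - s, with both subtractions moved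
    -- to the left. It is applied with s = 0 and s = 4.
    delete-leave : sum leaveDegree + s + s ≤ s * s + n
    delete-leave = begin
      sum leaveDegree + s + s
        ≤⟨ +-monoˡ-≤ s leave-bound ⟩
      s * s + sum (λ x → sum (matched x)) + s
        ≡⟨ +-assoc (s * s) _ s ⟩
      s * s + (sum (λ x → sum (matched x)) + s)
        ≡⟨ cong (λ u → s * s + (sum (λ x → sum (matched x)) + u)) sum-hole ⟨
      s * s + (sum (λ x → sum (matched x)) + sum hole)
        ≡⟨ cong (s * s +_) (∑-distrib-+ (λ x → sum (matched x)) hole) ⟨
      s * s + sum (λ x → sum (matched x) + hole x)
        ≤⟨ +-monoʳ-≤ (s * s) (sum-mono matched+hole) ⟩
      s * s + sum {n} (λ _ → 1)
        ≡⟨ cong (s * s +_) (trans (sum-const n 1) (*-identityʳ n)) ⟩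
      s * s + n ∎
      where open ≤-Reasoning

-- Each of the at most `k` lost blocks returns three edges to the leave, that is 6 to the degree
-- sum; if the total stays within 2 · f n, enough blocks remain.
enough-blocks : ∀ {n} (S : PartialTripleSystem (Fin n)) → let open Blocks S in
  ∀ k {l} → length blocks ≤ l + k → sum leaveDegree + 6 * k ≤ 2 * f n → n C 2 ≤ 3 * l + f n
enough-blocks {n} S k {l} lost small = *-cancelˡ-≤ 2 (begin
  2 * (n C 2)                            ≡⟨ edges-blocks blocks blocks-packing ⟨
  sum leaveDegree + 6 * length blocks    ≤⟨ +-monoʳ-≤ (sum leaveDegree) (*-monoʳ-≤ 6 lost) ⟩
  sum leaveDegree + 6 * (l + k)          ≡⟨ e₁ (sum leaveDegree) l k ⟩
  sum leaveDegree + 6 * k + 6 * l        ≤⟨ +-monoˡ-≤ (6 * l) small ⟩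
  2 * f n + 6 * l                        ≡⟨ e₂ (f n) l ⟩
  2 * (3 * l + f n)                      ∎)
  where
  open ≤-Reasoning
  open Blocks S
  e₁ : ∀ d l k → d + 6 * (l + k) ≡ d + 6 * k + 6 * l
  e₁ = solve-∀
  e₂ : ∀ v l → 2 * v + 6 * l ≡ 2 * (3 * l + v)
  e₂ = solve-∀

-- Packings that attain the bound

avoid : ∀ {n} (u v : Fin n) → u ≢ v → ∀ w → ∃[ x ] (x ≢ w × (x ≡ u ⊎ x ≡ v))
avoid u v u≢v w with u ≟ w
... | yes refl = v , u≢v ∘ sym , inj₂ refl
... | no  u≢w  = u , u≢w , inj₁ refl

lower-steiner : ∀ {m} (S : PartialTripleSystem (Fin (4 + m))) → Steiner S → f (4 + m) ≡ 9 → Lower (4 + m)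
lower-steiner {m} S steiner f≡ with steiner {0F} {1F} (λ ())
-- The fourth vertex must avoid 0, 1 and the unknown `c`; one of 2 and 3 does.
... | c , 01c with avoid 2F 3F (λ ()) c
... | d , d≢c , d∈ =
  removeThree 0F 1F d , Linear⇒IsPacking (removeThree-linear 0F 1F d) ,
  removeThree-K4e 01c (0≢d d∈) (1≢d d∈) (d≢c ∘ sym) ,
  enough-blocks S 3 (≤-trans (length-remove blocks-linear (0≢d d∈))
    (≤-trans (+-monoˡ-≤ 1 (removeThree-length {a = 0F} {1F} (λ ()) (1≢d d∈)))
      (≤-reflexive (+-assoc (length (removeThree 0F 1F d)) 2 1))))
    -- The system has an empty leave, and three lost blocks give 6 · 3 = 2 · 9.
    (≤-trans (+-monoˡ-≤ 18 (≤-trans (m≤m+n _ _) no-leave)) (≤-reflexive (cong (2 *_) (sym f≡))))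
  where
  open Blocks S
  0≢d : ∀ {d : Fin (4 + m)} → d ≡ 2F ⊎ d ≡ 3F → 0F ≢ d
  0≢d (inj₁ refl) ()
  0≢d (inj₂ refl) ()
  1≢d : ∀ {d : Fin (4 + m)} → d ≡ 2F ⊎ d ≡ 3F → 1F ≢ d
  1≢d (inj₁ refl) ()
  1≢d (inj₂ refl) ()
  no-leave : sum leaveDegree + 0 ≤ 0
  no-leave = ≤-trans (Holed.leave-bound {s = 0} S (λ ()) (λ _ _ → 0)
      (λ x≢y none → ⊥-elim (just≢nothing (proj₂ (steiner x≢y)) none)))
    (≤-reflexive (sum-zero {4 + m} (λ _ → sum-zero {4 + m} (λ _ → refl))))

lower-steiner-deleted : ∀ {m} (S : PartialTripleSystem (Fin (4 + m))) → Steiner S →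
  3 + m + 12 ≤ 2 * f (3 + m) → Lower (3 + m)
lower-steiner-deleted {m} S steiner f≥ with steiner {0F} {1F} (λ ())
... | zero , eq = ⊥-elim (PTS.distinct S (PTS.swap S eq) refl)
-- With `a` = 0F after deletion (the old point 1), `d` is the partner of `a` in the matching, so the
-- edge ad comes for free.
... | suc d , 0ad with avoid 1F 2F (λ ()) d
... | b , b≢d , b∈ with steiner {1F} {suc b} (a≢b b∈ ∘ Fin.suc-injective)
  where
  a≢b : ∀ {b : Fin (3 + m)} → b ≡ 1F ⊎ b ≡ 2F → 0F ≢ b
  a≢b (inj₁ refl) ()
  a≢b (inj₂ refl) ()
-- If the deleted point completed ab, then `b` would be the partner `d` of `a`.
... | zero , ab0 = ⊥-elim (b≢d (Fin.suc-injective (Maybe.just-injective (trans (sym (rotate (rotate ab0))) 0ad))))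
  where open PartialTripleSystem S using (rotate)
... | suc c , abc =
  removeThree 0F b d , Linear⇒IsPacking (removeThree-linear 0F b d) ,
  removeThree-K4e (third⁻-just abc) a≢d b≢d (λ { refl → case trans (sym (swap abc)) ad0 of λ () }) ,
  enough-blocks delete 2 (≤-trans (length-remove-leave blocks-linear (nothing-leaveEdge a≢d ad))
      (removeThree-length (PTS.distinct delete (third⁻-just abc)) b≢d))
    (≤-trans (+-monoˡ-≤ 12 (≤-trans (m≤m+n _ _) (≤-trans (m≤m+n _ _) few))) f≥)
  where
  open Deletion S
  open Blocks delete
  open PartialTripleSystem S using (swap; rotate; distinct)
  ad0 : PTS.third S 1F (suc d) ≡ just zero
  ad0 = rotate 0ad
  a≢d : 0F ≢ d
  a≢d a≡d = distinct (rotate 0ad) (cong suc a≡d)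
  ad : third⁻ 0F d ≡ nothing
  ad = cong (_>>= unzero) ad0
  few : sum leaveDegree + 0 + 0 ≤ 3 + m
  few = delete-leave {0} (λ ()) (λ { {()} }) (λ ())
    (λ x≢y none → ⊥-elim (just≢nothing (proj₂ (steiner (x≢y ∘ Fin.suc-injective))) none))

-- `Deletion` removes the point `zero`; `hole-zero` puts it into the hole, so that one record serves
-- both n ≡ 5 and n ≡ 4.
record FiveHole (n : ℕ) : Set where
  field
    system    : PartialTripleSystem (Fin (suc n))
    hole      : Fin 5 → Fin (suc n)
    hole-zero : hole 0F ≡ zero
    injective : ∀ {i j} → hole i ≡ hole j → i ≡ j
    empty     : ∀ i j → PTS.third system (hole i) (hole j) ≡ nothing
    cover     : ∀ {x y} → x ≢ y → PTS.third system x y ≡ nothing → (∃[ i ] x ≡ hole i) × (∃[ j ] y ≡ hole j)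

lower-hole : ∀ {n} → FiveHole n → f (suc n) ≡ 7 → Lower (suc n)
lower-hole {n} H f≡ =
  -- Filling the hole with the triangle 2, 3, 4 leaves the edge 01 and the six edges from 0 and 1 to
  -- it; K₄ - e sits on 0, 1, 2, 3.
  T ∷ blocks ,
  Linear⇒IsPacking (cons-linear T (≢ (λ ()) , ≢ (λ ()) , ≢ (λ ())) disjoint blocks-linear) ,
  (hole 0F , hole 1F , hole 2F , hole 3F ,
   ≢ (λ ()) , ≢ (λ ()) , ≢ (λ ()) , ≢ (λ ()) , ≢ (λ ()) , ≢ (λ ()) ,
   edge (λ ()) outside₀ , edge (λ ()) outside₀ , edge (λ ()) outside₀ ,
   edge (λ ()) outside₁ , edge (λ ()) outside₁) ,
  *-cancelˡ-≤ 2 (begin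
    2 * (suc n C 2)                        ≡⟨ edges-blocks blocks blocks-packing ⟨
    sum leaveDegree + 6 * length blocks    ≤⟨ +-monoˡ-≤ (6 * length blocks) small ⟩
    -- 20 is the degree sum of K₅; the added block lowers it to 14 = 2 · 7.
    20 + 6 * length blocks                 ≡⟨ e (length blocks) ⟩
    2 * (3 * suc (length blocks) + 7)      ≡⟨ cong (λ u → 2 * (3 * suc (length blocks) + u)) f≡ ⟨
    2 * (3 * suc (length blocks) + f (suc n)) ∎)
  where
  open ≤-Reasoning
  open FiveHole H
  open Blocks system
  e : ∀ l → 20 + 6 * l ≡ 2 * (3 * suc l + 7)
  e = solve-∀
  ≢_ : ∀ {i j} → i ≢ j → hole i ≢ hole j
  (≢ i≢j) eq = i≢j (injective eq)
  T : Triple (suc n)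
  T = hole 2F , hole 3F , hole 4F
  in-hole : ∀ {x} → x ∈B T → ∃[ i ] x ≡ hole i
  in-hole (inj₁ eq)        = 2F , eq
  in-hole (inj₂ (inj₁ eq)) = 3F , eq
  in-hole (inj₂ (inj₂ eq)) = 4F , eq
  uncovered : ∀ {B} i j → i ≢ j → B ∈ blocks → ¬ PairIn (hole i) (hole j) B
  uncovered i j i≢j B∈ ij∈ = just≢nothing (proj₁ (proj₂ (pair-third B∈ (≢ i≢j) ij∈))) (empty i j)
  disjoint : ∀ {B x y} → B ∈ blocks → x ≢ y → PairIn x y T → ¬ PairIn x y B
  disjoint B∈ x≢y (x∈ , y∈) with in-hole x∈ | in-hole y∈
  ... | i , refl | j , refl = uncovered i j (x≢y ∘ cong hole) B∈
  outside₀ : ¬ (hole 0F ∈B T)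
  outside₀ (inj₁ eq)        = (≢ (λ ())) eq
  outside₀ (inj₂ (inj₁ eq)) = (≢ (λ ())) eq
  outside₀ (inj₂ (inj₂ eq)) = (≢ (λ ())) eq
  outside₁ : ¬ (hole 1F ∈B T)
  outside₁ (inj₁ eq)        = (≢ (λ ())) eq
  outside₁ (inj₂ (inj₁ eq)) = (≢ (λ ())) eq
  outside₁ (inj₂ (inj₂ eq)) = (≢ (λ ())) eq
  edge : ∀ {i j} → i ≢ j → ¬ (hole i ∈B T) → LeaveEdge (T ∷ blocks) (hole i) (hole j)
  edge {i} {j} i≢j i∉ = leaveEdge (≢ i≢j) λ
    { (here refl) (p , _) → i∉ p ; (there B∈) → uncovered i j i≢j B∈ }
  small : sum leaveDegree ≤ 20
  small = +-cancelʳ-≤ 5 _ _ (≤-trans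
    (Holed.leave-bound system hole (λ _ _ → 0) (λ x≢y none → inj₁ (cover x≢y none)))
    (≤-reflexive (cong (25 +_) (sum-zero {suc n} (λ _ → sum-zero {suc n} (λ _ → refl))))))

lower-hole-deleted : ∀ {n} → FiveHole n → n + 8 ≤ 2 * f n → Lower n
lower-hole-deleted {n} H f≥ =
  blocks , blocks-packing ,
  (e 0F , e 1F , e 2F , e 3F ,
   ≢ (λ ()) , ≢ (λ ()) , ≢ (λ ()) , ≢ (λ ()) , ≢ (λ ()) , ≢ (λ ()) ,
   edge (λ ()) , edge (λ ()) , edge (λ ()) , edge (λ ()) , edge (λ ())) ,
  enough-blocks delete 0 (≤-reflexive (sym (+-identityʳ _)))
    (≤-trans (≤-reflexive (+-identityʳ _)) (≤-trans few f≥))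
  where
  open FiveHole H
  open Deletion system
  open Blocks delete
  predecessor : ∀ i → ∃[ x ] hole (suc i) ≡ suc x
  predecessor i with hole (suc i) in eq
  ... | suc x = x , refl
  ... | zero with () ← injective (trans eq (sym hole-zero))
  e : Fin 4 → Fin n
  e i = proj₁ (predecessor i)
  hole-suc : ∀ i → hole (suc i) ≡ suc (e i)
  hole-suc i = proj₂ (predecessor i)
  e-injective : ∀ {i j} → e i ≡ e j → i ≡ j
  e-injective {i} {j} eq = Fin.suc-injective
    (injective (trans (hole-suc i) (trans (cong suc eq) (sym (hole-suc j)))))
  ≢_ : ∀ {i j} → i ≢ j → e i ≢ e j
  (≢ i≢j) eq = i≢j (e-injective eq)
  empty⁻ : ∀ i j → PTS.third system (suc (e i)) (suc (e j)) ≡ nothing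
  empty⁻ i j = subst₂ (λ x y → PTS.third system x y ≡ nothing) (hole-suc i) (hole-suc j) (empty (suc i) (suc j))
  apart : ∀ j → PTS.third system zero (suc (e j)) ≡ nothing
  apart j = subst₂ (λ x y → PTS.third system x y ≡ nothing) hole-zero (hole-suc j) (empty 0F (suc j))
  edge : ∀ {i j} → i ≢ j → LeaveEdge blocks (e i) (e j)
  edge {i} {j} i≢j = nothing-leaveEdge (≢ i≢j) (cong (_>>= unzero) (empty⁻ i j))
  below : ∀ {x} → ∃[ i ] suc x ≡ hole i → ∃[ i ] x ≡ e i
  below (zero , eq) with () ← trans eq hole-zero
  below (suc i , eq) = i , Fin.suc-injective (trans eq (hole-suc i))
  few : sum leaveDegree ≤ n + 8
  few = +-cancelʳ-≤ 8 _ _ (≤-trans (≤-trans (≤-reflexive (sym (+-assoc (sum leaveDegree) 4 4)))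
    (delete-leave e e-injective apart (λ x≢y none →
      let (p , q) = cover (x≢y ∘ Fin.suc-injective) none in below p , below q)))
    (≤-reflexive (regroup n)))
    where
    regroup : ∀ n → 16 + n ≡ n + 8 + 8
    regroup = solve-∀

-- Constructions

-- A symmetric Latin square in equational form; by commutativity the left division also divides on
-- the right.
record CommutativeQuasigroup (Q : Set) : Set where
  infixl 7 _∙_ _\\_
  field
    _∙_       : Q → Q → Q
    _\\_      : Q → Q → Q
    ∙-comm    : ∀ x y → x ∙ y ≡ y ∙ x
    \\-solves : ∀ x z → x ∙ (x \\ z) ≡ z
    \\-unique : ∀ x y → x \\ (x ∙ y) ≡ y

  cancel : ∀ {x y z} → x ∙ y ≡ x ∙ z → y ≡ z
  cancel {x} {y} {z} eq = trans (sym (\\-unique x y)) (trans (cong (x \\_) eq) (\\-unique x z))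

-- Quasigroups from cyclic groups

module Residues (p : ℕ) where
  private
    m = suc p

  toℕ-mod : ∀ a → toℕ (a mod m) ≡ a % m
  toℕ-mod a = Fin.toℕ-fromℕ< (m%n<n a m)

  mod-cong : ∀ a b → a % m ≡ b % m → a mod m ≡ b mod m
  mod-cong a b eq = Fin.toℕ-injective (trans (toℕ-mod a) (trans eq (sym (toℕ-mod b))))

  mod-toℕ : ∀ (i : Fin m) → toℕ i mod m ≡ i
  mod-toℕ i = Fin.toℕ-injective (trans (toℕ-mod (toℕ i)) (m<n⇒m%n≡m (Fin.toℕ<n i)))

  mod-+-multiple : ∀ {a} b k → a ≡ b + k * m → a mod m ≡ b mod m
  mod-+-multiple b k refl = mod-cong (b + k * m) b ([m+kn]%n≡m%n b k m)

  mod-+ : ∀ a b → (a + toℕ (b mod m)) mod m ≡ (a + b) mod m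
  mod-+ a b = mod-cong (a + toℕ (b mod m)) (a + b) (trans (cong (λ u → (a + u) % m) (toℕ-mod b))
    (trans (%-distribˡ-+ a (b % m) m)
      (trans (cong (λ u → (a % m + u) % m) (m%n%n≡m%n b m)) (sym (%-distribˡ-+ a b m)))))

  mod-* : ∀ a b → (a * toℕ (b mod m)) mod m ≡ (a * b) mod m
  mod-* a b = mod-cong (a * toℕ (b mod m)) (a * b) (trans (cong (λ u → (a * u) % m) (toℕ-mod b))
    (trans (%-distribˡ-* a (b % m) m)
      (trans (cong (λ u → (a % m * u) % m) (m%n%n≡m%n b m)) (sym (%-distribˡ-* a b m)))))

  -- The Cayley table of ℤ/m, with arguments labelled by v and values by w; −x is p · x.
  isotope : ∀ {Q : Set} (v w : Fin m ↔ Q) → CommutativeQuasigroup Q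
  isotope {Q} v w = record
    { _∙_       = λ x y → to w ((α x + α y) mod m)
    ; _\\_      = λ x z → to v ((β z + p * α x) mod m)
    ; ∙-comm    = λ x y → cong (λ u → to w (u mod m)) (+-comm (α x) (α y))
    ; \\-solves = λ x z → begin
        to w ((α x + α (to v ((β z + p * α x) mod m))) mod m)
          ≡⟨ cong (λ u → to w ((α x + toℕ u) mod m)) (strictlyInverseʳ v _) ⟩
        to w ((α x + toℕ ((β z + p * α x) mod m)) mod m)
          ≡⟨ cong (to w) (mod-+ (α x) (β z + p * α x)) ⟩
        to w ((α x + (β z + p * α x)) mod m)
          ≡⟨ cong (to w) (mod-+-multiple (β z) (α x) (e₁ (α x) (β z) p)) ⟩
        to w (β z mod m)
          ≡⟨ cong (to w) (mod-toℕ (from w z)) ⟩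
        to w (from w z)
          ≡⟨ strictlyInverseˡ w z ⟩
        z ∎
    ; \\-unique = λ x y → begin
        to v ((β (to w ((α x + α y) mod m)) + p * α x) mod m)
          ≡⟨ cong (λ u → to v ((toℕ u + p * α x) mod m)) (strictlyInverseʳ w _) ⟩
        to v ((toℕ ((α x + α y) mod m) + p * α x) mod m)
          ≡⟨ cong (λ u → to v (u mod m)) (+-comm _ (p * α x)) ⟩
        to v ((p * α x + toℕ ((α x + α y) mod m)) mod m)
          ≡⟨ cong (to v) (mod-+ (p * α x) (α x + α y)) ⟩
        to v ((p * α x + (α x + α y)) mod m)
          ≡⟨ cong (to v) (mod-+-multiple (α y) (α x) (e₂ (α x) (α y) p)) ⟩
        to v (α y mod m)
          ≡⟨ cong (to v) (mod-toℕ (from v y)) ⟩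
        to v (from v y)
          ≡⟨ strictlyInverseˡ v y ⟩
        y ∎
    }
    where
    open ≡-Reasoning
    α β : Q → ℕ
    α x = toℕ (from v x)
    β x = toℕ (from w x)
    e₁ : ∀ x z p → x + (z + p * x) ≡ z + x * suc p
    e₁ = solve-∀
    e₂ : ∀ x y p → p * x + (x + y) ≡ y + x * suc p
    e₂ = solve-∀

square : ∀ {Q} → CommutativeQuasigroup Q → Q → Q
square G x = x ∙ x
  where open CommutativeQuasigroup G

Idempotent : ∀ {Q} → CommutativeQuasigroup Q → Set
Idempotent G = ∀ x → square G x ≡ x

module OddOrder (k : ℕ) {Q : Set} (enumeration : Fin (suc (k * 2)) ↔ Q) where
  open Residues (k * 2)
  private
    m : ℕ
    m = suc (k * 2)

  -- Modulo 2k + 1 the inverse of 2 is k + 1, since 2(k + 1) = 1 + (2k + 1).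
  halving : Fin m ↔ Fin m
  halving = mk↔ₛ′ (λ s → (suc k * toℕ s) mod m) (λ z → (2 * toℕ z) mod m)
    (λ z → trans (mod-* (suc k) (2 * toℕ z))
      (trans (mod-+-multiple (toℕ z) (toℕ z) (e₁ k (toℕ z))) (mod-toℕ z)))
    (λ s → trans (mod-* 2 (suc k * toℕ s))
      (trans (mod-+-multiple (toℕ s) (toℕ s) (e₂ k (toℕ s))) (mod-toℕ s)))
    where
    e₁ : ∀ k z → suc k * (2 * z) ≡ z + z * suc (k * 2)
    e₁ = solve-∀
    e₂ : ∀ k s → 2 * (suc k * s) ≡ s + s * suc (k * 2)
    e₂ = solve-∀

  -- In the labels the product is (x + y)/2, which is why it is idempotent.
  midpoint : CommutativeQuasigroup Q
  midpoint = isotope enumeration (enumeration ↔-∘ halving)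

  midpoint-idem : Idempotent midpoint
  midpoint-idem x = begin
    to enumeration (to halving ((a + a) mod m))  ≡⟨ cong (λ u → to enumeration (to halving ((a + u) mod m))) (+-identityʳ a) ⟨
    to enumeration (to halving (from halving i)) ≡⟨ cong (to enumeration) (strictlyInverseˡ halving i) ⟩
    to enumeration i                             ≡⟨ strictlyInverseˡ enumeration x ⟩
    x                                            ∎
    where
    open ≡-Reasoning
    i = from enumeration x
    a = toℕ i

module EvenOrder (k′ : ℕ) where
  private
    k = suc k′
    m = k * 2
  open Residues (suc (k′ * 2))

  -- (j , b) is read as b k + j in the arguments and as 2 j + b in the values,
  -- so that (j , b) ∙ (j , b) = (j , 0).
  arguments values : Fin m ↔ (Fin k × Fin 2)
  arguments = ×-comm (Fin 2) (Fin k) ↔-∘ (Fin.*↔× {2} {k} ↔-∘ cast-id (*-comm k 2))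
  values    = Fin.*↔× {k} {2}

  halfIdempotent : CommutativeQuasigroup (Fin k × Fin 2)
  halfIdempotent = isotope arguments values

  -- 2(bk + j) = 2j + b(2k) is congruent to 2j modulo 2k, so `b` is lost, and 2j is the value label
  -- of (j, 0).
  square-halfIdempotent : ∀ j b → square halfIdempotent (j , b) ≡ (j , 0F)
  square-halfIdempotent j b = trans (cong (to values) (begin
    (toℕ i + toℕ i) mod m           ≡⟨ mod-+-multiple (toℕ (from values (j , 0F))) (toℕ b) double ⟩
    toℕ (from values (j , 0F)) mod m ≡⟨ mod-toℕ (from values (j , 0F)) ⟩
    from values (j , 0F)             ∎)) (strictlyInverseˡ values (j , 0F))
    where
    open ≡-Reasoning
    i = from arguments (j , b)
    i≡ : toℕ i ≡ k * toℕ b + toℕ j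
    i≡ = trans (Fin.toℕ-cast _ (combine b j)) (Fin.toℕ-combine b j)
    e : ∀ k b j → (k * b + j) + (k * b + j) ≡ (2 * j + 0) + b * (k * 2)
    e = solve-∀
    double : toℕ i + toℕ i ≡ toℕ (from values (j , 0F)) + toℕ b * m
    double = trans (cong₂ _+_ i≡ i≡) (trans (e k (toℕ b) (toℕ j))
      (cong (_+ toℕ b * m) (sym (Fin.toℕ-combine j 0F))))

-- Triple systems on three levels and added points

next : Fin 3 → Fin 3
next 0F = 1F
next 1F = 2F
next 2F = 0F

-- Bose's blocks {(x,i), (y,i), (x ∙ y, i+1)} for x ≠ y, and {(x,0), (x,1), (x,2)} for x in T.
module Bose {Q : Set} (_≟_ : DecidableEquality Q) (G : Fin 3 → CommutativeQuasigroup Q) (T : Q → Bool)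
  (T-idem : ∀ {x} → T x ≡ true → ∀ i → square (G i) x ≡ x) where

  private
    module G i = CommutativeQuasigroup (G i)
    op ld : Fin 3 → Q → Q → Q
    op i = CommutativeQuasigroup._∙_ (G i)
    ld i = CommutativeQuasigroup._\\_ (G i)

  Point : Set
  Point = Q × Fin 3

  level : Fin 3 → Q → Q → Maybe Point
  level i x y with x ≟ y
  ... | yes _ = nothing
  ... | no  _ = just (op i x y , next i)

  -- For the points (x, i) and (z, i+1) the product equation is solved for the second factor. If `z`
  -- is the square of `x`, the solution is `x` itself and gives no block: such a pair goes to a
  -- vertical triple when `T x` holds and stays uncovered otherwise.
  rise : Fin 3 → Q → Q → Maybe Point
  rise i x z with op i x x ≟ z
  ... | yes _ = if T x then just (x , next (next i)) else nothing
  ... | no  _ = just (ld i x z , i)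

  third : Point → Point → Maybe Point
  third (x , 0F) (y , 0F) = level 0F x y
  third (x , 0F) (y , 1F) = rise 0F x y
  third (x , 0F) (y , 2F) = rise 2F y x
  third (x , 1F) (y , 0F) = rise 0F y x
  third (x , 1F) (y , 1F) = level 1F x y
  third (x , 1F) (y , 2F) = rise 1F x y
  third (x , 2F) (y , 0F) = rise 2F x y
  third (x , 2F) (y , 1F) = rise 1F y x
  third (x , 2F) (y , 2F) = level 2F x y

  diagonal : Point → Point
  diagonal (x , i) = op i x x , next i

  level-refl : ∀ i x → level i x x ≡ nothing
  level-refl i x with x ≟ x
  ... | yes _  = refl
  ... | no x≢x = ⊥-elim (x≢x refl)

  level-comm : ∀ i x y → level i x y ≡ level i y x
  level-comm i x y with x ≟ y | y ≟ x
  ... | yes _   | yes _   = refl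
  ... | yes x≡y | no  y≢x = ⊥-elim (y≢x (sym x≡y))
  ... | no  x≢y | yes y≡x = ⊥-elim (x≢y (sym y≡x))
  ... | no  _   | no  _   = cong (λ u → just (u , next i)) (G.∙-comm i x y)

  level-≢ : ∀ i {x y} → x ≢ y → level i x y ≡ just (op i x y , next i)
  level-≢ i {x} {y} x≢y with x ≟ y
  ... | yes x≡y = ⊥-elim (x≢y x≡y)
  ... | no  _   = refl

  rise-off : ∀ i {x z} → op i x x ≢ z → rise i x z ≡ just (ld i x z , i)
  rise-off i {x} {z} xx≢z with op i x x ≟ z
  ... | yes xx≡z = ⊥-elim (xx≢z xx≡z)
  ... | no  _    = refl

  rise-diagonal : ∀ i x → rise i x (op i x x) ≡ (if T x then just (x , next (next i)) else nothing)
  rise-diagonal i x with op i x x ≟ op i x x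
  ... | yes _ = refl
  ... | no ≢  = ⊥-elim (≢ refl)

  rise-triangle : ∀ i {x} → T x ≡ true → rise i x x ≡ just (x , next (next i))
  rise-triangle i {x} Tx = trans (cong (rise i x) (sym (T-idem Tx i)))
    (trans (rise-diagonal i x) (cong (if_then just (x , next (next i)) else nothing) Tx))

  data Level (i : Fin 3) (x y : Q) : Point → Set where
    leveled : x ≢ y → Level i x y (op i x y , next i)

  level-just : ∀ i {x y r} → level i x y ≡ just r → Level i x y r
  level-just i {x} {y} eq with x ≟ y
  level-just i refl | no x≢y = leveled x≢y

  data Rise (i : Fin 3) (x z : Q) : Point → Set where
    triangle : z ≡ x → T x ≡ true → Rise i x z (x , next (next i))
    off      : op i x x ≢ z → Rise i x z (ld i x z , i)

  rise-just : ∀ i {x z r} → rise i x z ≡ just r → Rise i x z r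
  rise-just i {x} {z} eq with op i x x ≟ z
  rise-just i {x} {z} eq | yes xx≡z with T x in Tx
  rise-just i {x} {z} refl | yes xx≡z | true = triangle (trans (sym xx≡z) (T-idem Tx i)) Tx
  rise-just i refl | no xx≢z = off xx≢z

  rise-∙ : ∀ i {x y} → x ≢ y → rise i x (op i x y) ≡ just (y , i)
  rise-∙ i {x} {y} x≢y = trans (rise-off i (x≢y ∘ G.cancel i))
    (cong (λ u → just (u , i)) (G.\\-unique i x y))

  level-\\ : ∀ i {x z} → op i x x ≢ z → level i x (ld i x z) ≡ just (z , next i)
  level-\\ i {x} {z} xx≢z =
    trans (level-≢ i (λ x≡ → xx≢z (trans (cong (op i x) x≡) (G.\\-solves i x z))))
      (cong (λ u → just (u , next i)) (G.\\-solves i x z))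

  rise-\\ : ∀ i {x z} → op i x x ≢ z → rise i (ld i x z) z ≡ just (x , i)
  rise-\\ i {x} {z} xx≢z = trans (cong (rise i l) (sym l∙x≡z)) (rise-∙ i l≢x)
    where
    l = ld i x z
    l∙x≡z : op i l x ≡ z
    l∙x≡z = trans (G.∙-comm i l x) (G.\\-solves i x z)
    l≢x : l ≢ x
    l≢x l≡x = xx≢z (trans (cong (λ u → op i u x) (sym l≡x)) l∙x≡z)

  third-irrefl : ∀ p → third p p ≡ nothing
  third-irrefl (x , 0F) = level-refl 0F x
  third-irrefl (x , 1F) = level-refl 1F x
  third-irrefl (x , 2F) = level-refl 2F x

  third-comm : ∀ p q → third p q ≡ third q p
  third-comm (x , 0F) (y , 0F) = level-comm 0F x y
  third-comm (x , 0F) (y , 1F) = refl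
  third-comm (x , 0F) (y , 2F) = refl
  third-comm (x , 1F) (y , 0F) = refl
  third-comm (x , 1F) (y , 1F) = level-comm 1F x y
  third-comm (x , 1F) (y , 2F) = refl
  third-comm (x , 2F) (y , 0F) = refl
  third-comm (x , 2F) (y , 1F) = refl
  third-comm (x , 2F) (y , 2F) = level-comm 2F x y

  third-swap : ∀ p q {r} → third p q ≡ just r → third p r ≡ just q
  third-swap (x , 0F) (y , 0F) eq with leveled x≢y ← level-just 0F eq = rise-∙ 0F x≢y
  third-swap (x , 1F) (y , 1F) eq with leveled x≢y ← level-just 1F eq = rise-∙ 1F x≢y
  third-swap (x , 2F) (y , 2F) eq with leveled x≢y ← level-just 2F eq = rise-∙ 2F x≢y
  third-swap (x , 0F) (y , 1F) eq with rise-just 0F eq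
  ... | triangle refl Tx = rise-triangle 2F Tx
  ... | off xx≢y         = level-\\ 0F xx≢y
  third-swap (x , 1F) (y , 2F) eq with rise-just 1F eq
  ... | triangle refl Tx = rise-triangle 0F Tx
  ... | off xx≢y         = level-\\ 1F xx≢y
  third-swap (x , 2F) (y , 0F) eq with rise-just 2F eq
  ... | triangle refl Tx = rise-triangle 1F Tx
  ... | off xx≢y         = level-\\ 2F xx≢y
  third-swap (x , 1F) (y , 0F) eq with rise-just 0F eq
  ... | triangle refl Tx = rise-triangle 1F Tx
  ... | off yy≢x         = rise-\\ 0F yy≢x
  third-swap (x , 2F) (y , 1F) eq with rise-just 1F eq
  ... | triangle refl Tx = rise-triangle 2F Tx
  ... | off yy≢x         = rise-\\ 1F yy≢x
  third-swap (x , 0F) (y , 2F) eq with rise-just 2F eq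
  ... | triangle refl Tx = rise-triangle 0F Tx
  ... | off yy≢x         = rise-\\ 2F yy≢x

  system : PartialTripleSystem Point
  system = record { third = third ; irrefl = third-irrefl ; comm = third-comm ; swap = λ {p} {q} → third-swap p q }

  third-diagonal : ∀ p → T (proj₁ p) ≡ false → third p (diagonal p) ≡ nothing
  third-diagonal (x , 0F) ¬Tx = trans (rise-diagonal 0F x) (cong (if_then just (x , 2F) else nothing) ¬Tx)
  third-diagonal (x , 1F) ¬Tx = trans (rise-diagonal 1F x) (cong (if_then just (x , 0F) else nothing) ¬Tx)
  third-diagonal (x , 2F) ¬Tx = trans (rise-diagonal 2F x) (cong (if_then just (x , 1F) else nothing) ¬Tx)

  Diagonal : Point → Point → Set
  Diagonal p q = diagonal p ≡ q × T (proj₁ p) ≡ false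

  level-nothing : ∀ i {x y} → level i x y ≡ nothing → x ≡ y
  level-nothing i {x} {y} eq with x ≟ y
  ... | yes x≡y = x≡y

  rise-nothing : ∀ i {x z} → rise i x z ≡ nothing → Diagonal (x , i) (z , next i)
  rise-nothing i {x} {z} eq with op i x x ≟ z
  ... | yes xx≡z with T x
  ...   | false = cong (_, next i) xx≡z , refl

  third-nothing : ∀ p q → p ≢ q → third p q ≡ nothing → Diagonal p q ⊎ Diagonal q p
  third-nothing (x , 0F) (y , 0F) p≢q eq = ⊥-elim (p≢q (cong (_, 0F) (level-nothing 0F eq)))
  third-nothing (x , 0F) (y , 1F) p≢q eq = inj₁ (rise-nothing 0F eq)
  third-nothing (x , 0F) (y , 2F) p≢q eq = inj₂ (rise-nothing 2F eq)
  third-nothing (x , 1F) (y , 0F) p≢q eq = inj₂ (rise-nothing 0F eq)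
  third-nothing (x , 1F) (y , 1F) p≢q eq = ⊥-elim (p≢q (cong (_, 1F) (level-nothing 1F eq)))
  third-nothing (x , 1F) (y , 2F) p≢q eq = inj₁ (rise-nothing 1F eq)
  third-nothing (x , 2F) (y , 0F) p≢q eq = inj₁ (rise-nothing 2F eq)
  third-nothing (x , 2F) (y , 1F) p≢q eq = inj₂ (rise-nothing 1F eq)
  third-nothing (x , 2F) (y , 2F) p≢q eq = ⊥-elim (p≢q (cong (_, 2F) (level-nothing 2F eq)))

-- Adds a point ∞ = nothing with the blocks {∞, p, τ p} for p not fixed by τ.
module Cone {A : Set} (_≟_ : DecidableEquality A) (S : PartialTripleSystem A)
  (τ : A → A) (involutive : ∀ p → τ (τ p) ≡ p)
  (free : ∀ p → PTS.third S p (τ p) ≡ nothing) where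
  private module S = PartialTripleSystem S

  apex : A → Maybe (Maybe A)
  apex p with τ p ≟ p
  ... | yes _ = nothing
  ... | no  _ = just (just (τ p))

  -- The test `p ≟ q` excludes the fixed points of `τ`, where the new block would degenerate.
  chord : A → A → Maybe (Maybe A)
  chord p q with τ p ≟ q | p ≟ q
  ... | yes _ | no _  = just nothing
  ... | yes _ | yes _ = nothing
  ... | no  _ | _     = nothing

  third : Maybe A → Maybe A → Maybe (Maybe A)
  third nothing  nothing  = nothing
  third nothing  (just q) = apex q
  third (just p) nothing  = apex p
  third (just p) (just q) with S.third p q
  ... | just r  = just (just r)
  ... | nothing = chord p q

  third-old : ∀ {p q r} → S.third p q ≡ just r → third (just p) (just q) ≡ just (just r)
  third-old eq rewrite eq = refl

  third-new : ∀ p q → S.third p q ≡ nothing → third (just p) (just q) ≡ chord p q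
  third-new p q eq rewrite eq = refl

  apex-just : ∀ {p r} → apex p ≡ just r → r ≡ just (τ p) × τ p ≢ p
  apex-just {p} eq with τ p ≟ p
  apex-just refl | no τp≢p = refl , τp≢p

  apex-moved : ∀ p → τ p ≢ p → apex p ≡ just (just (τ p))
  apex-moved p τp≢p with τ p ≟ p
  ... | yes τp≡p = ⊥-elim (τp≢p τp≡p)
  ... | no  _    = refl

  apex-fixed : ∀ p → τ p ≡ p → apex p ≡ nothing
  apex-fixed p τp≡p with τ p ≟ p
  ... | yes _    = refl
  ... | no  τp≢p = ⊥-elim (τp≢p τp≡p)

  apex-nothing : ∀ {p} → apex p ≡ nothing → τ p ≡ p
  apex-nothing {p} eq with τ p ≟ p
  ... | yes τp≡p = τp≡p

  chord-just : ∀ {p q r} → chord p q ≡ just r → r ≡ nothing × τ p ≡ q × p ≢ q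
  chord-just {p} {q} eq with τ p ≟ q | p ≟ q
  chord-just refl | yes τp≡q | no p≢q = refl , τp≡q , p≢q

  chord-edge : ∀ p → τ p ≢ p → chord p (τ p) ≡ just nothing
  chord-edge p τp≢p with τ p ≟ τ p | p ≟ τ p
  ... | yes _ | no _  = refl
  ... | yes _ | yes ≡ = ⊥-elim (τp≢p (sym ≡))
  ... | no ≢  | _     = ⊥-elim (≢ refl)

  chord-other : ∀ p q → τ p ≢ q ⊎ p ≡ q → chord p q ≡ nothing
  chord-other p q why with τ p ≟ q | p ≟ q
  chord-other p q why         | no  _    | _     = refl
  chord-other p q why         | yes _    | yes _ = refl
  chord-other p q (inj₁ τp≢q) | yes τp≡q | no _   = ⊥-elim (τp≢q τp≡q)
  chord-other p q (inj₂ p≡q)  | yes _    | no p≢q = ⊥-elim (p≢q p≡q)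

  chord-comm : ∀ p q → chord p q ≡ chord q p
  chord-comm p q with τ p ≟ q | p ≟ q
  ... | yes refl | no p≢q  = sym (trans (cong (chord (τ p)) (sym (involutive p)))
                              (chord-edge (τ p) (λ eq → p≢q (trans (sym (involutive p)) eq))))
  ... | yes _    | yes p≡q = sym (chord-other q p (inj₂ (sym p≡q)))
  ... | no  τp≢q | _       = sym (chord-other q p (inj₁ (λ { refl → τp≢q (involutive q) })))

  third-irrefl : ∀ p → third p p ≡ nothing
  third-irrefl nothing  = refl
  third-irrefl (just p) = trans (third-new p p (S.irrefl p)) (chord-other p p (inj₂ refl))

  third-comm : ∀ p q → third p q ≡ third q p
  third-comm nothing  nothing  = refl
  third-comm nothing  (just q) = refl
  third-comm (just p) nothing  = refl
  third-comm (just p) (just q) with S.third p q in eq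
  ... | just r  = sym (third-old (trans (S.comm q p) eq))
  ... | nothing = trans (chord-comm p q) (sym (third-new q p (trans (S.comm q p) eq)))

  third-swap : ∀ p q {r} → third p q ≡ just r → third p r ≡ just q
  third-swap nothing (just q) eq with refl , τq≢q ← apex-just {q} eq =
    trans (apex-moved (τ q) (λ e → τq≢q (trans (sym e) (involutive q)))) (cong (just ∘ just) (involutive q))
  third-swap (just p) nothing eq with refl , τp≢p ← apex-just {p} eq =
    trans (third-new p (τ p) (free p)) (chord-edge p τp≢p)
  third-swap (just p) (just q) eq with S.third p q in pq
  third-swap (just p) (just q) refl | just r = third-old (S.swap pq)
  third-swap (just p) (just q) eq | nothing with refl , refl , p≢τp ← chord-just {p} {q} eq =
    apex-moved p (p≢τp ∘ sym)

  cone : PartialTripleSystem (Maybe A)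
  cone = record { third = third ; irrefl = third-irrefl ; comm = third-comm ; swap = λ {p} {q} → third-swap p q }

  third-nothing : ∀ {p q} → p ≢ q → third (just p) (just q) ≡ nothing → S.third p q ≡ nothing × τ p ≢ q
  third-nothing {p} {q} p≢q eq with S.third p q in pq
  ... | nothing = refl , λ { refl → just≢nothing (chord-edge p (p≢q ∘ sym)) eq }

-- Relabelling, Steiner triple systems and the system with a hole

module _ {n} {A : Set} (enumeration : Fin n ↔ A) (S : PartialTripleSystem A) where
  private
    module S = PartialTripleSystem S
    ⌊_⌋ = to enumeration
    ⌈_⌉ = from enumeration

  transportedThird : Fin n → Fin n → Maybe (Fin n)
  transportedThird i j = Maybe.map ⌈_⌉ (S.third ⌊ i ⌋ ⌊ j ⌋)

  transported-just : ∀ {i j r} → S.third ⌊ i ⌋ ⌊ j ⌋ ≡ just r → transportedThird i j ≡ just ⌈ r ⌉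
  transported-just eq rewrite eq = refl

  just-transported : ∀ {i j k} → transportedThird i j ≡ just k → S.third ⌊ i ⌋ ⌊ j ⌋ ≡ just ⌊ k ⌋
  just-transported {i} {j} eq with S.third ⌊ i ⌋ ⌊ j ⌋
  just-transported refl | just r = cong just (sym (strictlyInverseˡ enumeration r))

  nothing-transported : ∀ {i j} → transportedThird i j ≡ nothing → S.third ⌊ i ⌋ ⌊ j ⌋ ≡ nothing
  nothing-transported {i} {j} eq with S.third ⌊ i ⌋ ⌊ j ⌋
  ... | nothing = refl

  to-injective : ∀ {i j} → ⌊ i ⌋ ≡ ⌊ j ⌋ → i ≡ j
  to-injective {i} {j} eq = trans (sym (strictlyInverseʳ enumeration i))
    (trans (cong ⌈_⌉ eq) (strictlyInverseʳ enumeration j))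

  transport : PartialTripleSystem (Fin n)
  transport = record
    { third  = transportedThird
    ; irrefl = λ i → cong (Maybe.map ⌈_⌉) (S.irrefl ⌊ i ⌋)
    ; comm   = λ i j → cong (Maybe.map ⌈_⌉) (S.comm ⌊ i ⌋ ⌊ j ⌋)
    ; swap   = λ {i} {j} eq → trans (transported-just (S.swap (just-transported eq)))
                                (cong just (strictlyInverseʳ enumeration j))
    }

  transport-steiner : Steiner S → Steiner transport
  transport-steiner steiner i≢j = _ , transported-just (proj₂ (steiner (i≢j ∘ to-injective)))

Maybe-enumeration : ∀ {n} {A : Set} → Fin n ↔ A → Fin (suc n) ↔ Maybe A
Maybe-enumeration e = mk↔ₛ′
  (λ { zero → nothing ; (suc i) → just (to e i) })
  (λ { nothing → zero ; (just x) → suc (from e x) })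
  (λ { nothing → refl ; (just x) → cong just (strictlyInverseˡ e x) })
  (λ { zero → refl ; (suc i) → cong suc (strictlyInverseʳ e i) })

module Triangles (k : ℕ) (G : CommutativeQuasigroup (Fin (suc (k * 2)))) (idem : Idempotent G) where
  all-idem : ∀ {x} → true ≡ true → (i : Fin 3) → square G x ≡ x
  all-idem {x} _ _ = idem x

  open Bose Fin._≟_ (λ _ → G) (λ _ → true) all-idem public using (system; third-nothing)

  steiner : Steiner system
  steiner {p} {q} p≢q with PTS.third system p q in eq
  ... | just r  = r , refl
  ... | nothing with third-nothing p q p≢q eq
  ...   | inj₁ (_ , ())
  ...   | inj₂ (_ , ())

steiner-3 : ∀ k → ∃[ S ] Steiner {Fin (3 + k * 2 * 3)} S
steiner-3 k = transport points system , transport-steiner points system steiner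
  where
  open OddOrder k (↔-id (Fin (suc (k * 2))))
  open Triangles k midpoint midpoint-idem
  points : Fin (3 + k * 2 * 3) ↔ (Fin (suc (k * 2)) × Fin 3)
  points = Fin.*↔× {suc (k * 2)} {3}

module Skolem (k : ℕ) (G : CommutativeQuasigroup (Fin k × Fin 2))
  (half : ∀ j b → square G (j , b) ≡ (j , 0F)) where

  Q : Set
  Q = Fin k × Fin 2

  low : Q → Bool
  low (_ , 0F) = true
  low (_ , 1F) = false

  low-idem : ∀ {x} → low x ≡ true → (i : Fin 3) → square G x ≡ x
  low-idem {j , 0F} _ _ = half j 0F
  low-idem {j , 1F} () _

  _≟Q_ : DecidableEquality Q
  _≟Q_ = Product.≡-dec Fin._≟_ Fin._≟_

  open Bose _≟Q_ (λ _ → G) low low-idem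
    using (Point; system; diagonal; third-diagonal; third-nothing)

  -- The uncovered pairs join ((j, 1), i) to ((j, 0), i+1). They form a perfect matching, which a
  -- single new point absorbs completely.
  partner : Point → Point
  partner ((j , 1F) , 0F) = (j , 0F) , 1F
  partner ((j , 1F) , 1F) = (j , 0F) , 2F
  partner ((j , 1F) , 2F) = (j , 0F) , 0F
  partner ((j , 0F) , 0F) = (j , 1F) , 2F
  partner ((j , 0F) , 1F) = (j , 1F) , 0F
  partner ((j , 0F) , 2F) = (j , 1F) , 1F

  partner-involutive : ∀ p → partner (partner p) ≡ p
  partner-involutive ((j , 1F) , 0F) = refl
  partner-involutive ((j , 1F) , 1F) = refl
  partner-involutive ((j , 1F) , 2F) = refl
  partner-involutive ((j , 0F) , 0F) = refl
  partner-involutive ((j , 0F) , 1F) = refl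
  partner-involutive ((j , 0F) , 2F) = refl

  partner-moves : ∀ p → partner p ≢ p
  partner-moves ((j , 1F) , 0F) ()
  partner-moves ((j , 1F) , 1F) ()
  partner-moves ((j , 1F) , 2F) ()
  partner-moves ((j , 0F) , 0F) ()
  partner-moves ((j , 0F) , 1F) ()
  partner-moves ((j , 0F) , 2F) ()

  diagonal-partner : ∀ p → low (proj₁ p) ≡ false → diagonal p ≡ partner p
  diagonal-partner ((j , 1F) , 0F) _ = cong (_, 1F) (half j 1F)
  diagonal-partner ((j , 1F) , 1F) _ = cong (_, 2F) (half j 1F)
  diagonal-partner ((j , 1F) , 2F) _ = cong (_, 0F) (half j 1F)

  high-free : ∀ p → low (proj₁ p) ≡ false → PTS.third system p (partner p) ≡ nothing
  high-free p high = trans (cong (PTS.third system p) (sym (diagonal-partner p high))) (third-diagonal p high)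

  low-free : ∀ p → low (proj₁ (partner p)) ≡ false → PTS.third system p (partner p) ≡ nothing
  low-free p high = trans (PTS.comm system p (partner p))
    (trans (cong (PTS.third system (partner p)) (sym (partner-involutive p))) (high-free (partner p) high))

  partner-free : ∀ p → PTS.third system p (partner p) ≡ nothing
  partner-free p@((_ , 1F) , _)  = high-free p refl
  partner-free p@((_ , 0F) , 0F) = low-free p refl
  partner-free p@((_ , 0F) , 1F) = low-free p refl
  partner-free p@((_ , 0F) , 2F) = low-free p refl

  module C = Cone (Product.≡-dec _≟Q_ Fin._≟_) system partner partner-involutive partner-free

  steiner : Steiner C.cone
  steiner {nothing} {nothing} ≢ = ⊥-elim (≢ refl)
  steiner {nothing} {just q}  _ = _ , C.apex-moved q (partner-moves q)
  steiner {just p}  {nothing} _ = _ , C.apex-moved p (partner-moves p)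
  steiner {just p}  {just q}  p≢q with C.third (just p) (just q) in eq
  ... | just r  = r , refl
  ... | nothing with C.third-nothing (p≢q ∘ cong just) eq
  ...   | free , partner≢ with third-nothing p q (p≢q ∘ cong just) free
  ...     | inj₁ (refl , high) = ⊥-elim (partner≢ (sym (diagonal-partner p high)))
  ...     | inj₂ (refl , high) =
              ⊥-elim (partner≢ (trans (cong partner (diagonal-partner q high)) (partner-involutive q)))

steiner-1 : ∀ k → ∃[ S ] Steiner {Fin (1 + suc k * 2 * 3)} S
steiner-1 k = transport points C.cone , transport-steiner points C.cone steiner
  where
  open EvenOrder k using (halfIdempotent; square-halfIdempotent)
  open Skolem (suc k) halfIdempotent square-halfIdempotent
  points : Fin (1 + suc k * 2 * 3) ↔ Maybe (Q × Fin 3)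
  points = Maybe-enumeration ((Fin.*↔× {suc k} {2} ×-↔ ↔-id (Fin 3)) ↔-∘ Fin.*↔× {suc k * 2} {3})

-- The quasigroup for the top level is twisted by the involution ν, which fixes only
-- the origin; away from it the diagonal then decomposes into the hexagons
-- (x,0), (x,1), (x,2), (ν x,0), (ν x,1), (ν x,2), whose edges are matched alternately to two new points.
module Hexagons (k : ℕ) (G : CommutativeQuasigroup (Maybe (Fin k × Fin 2))) (idem : Idempotent G) where

  Q : Set
  Q = Maybe (Fin k × Fin 2)

  -- Leaving the top level through `ν` delays the return to (x, 0) by one more round, so the cycle
  -- length doubles from 3 to 6 wherever `ν` moves `x`.
  ν : Q → Q
  ν nothing         = nothing
  ν (just (j , 0F)) = just (j , 1F)
  ν (just (j , 1F)) = just (j , 0F)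

  ν-involutive : ∀ x → ν (ν x) ≡ x
  ν-involutive nothing         = refl
  ν-involutive (just (j , 0F)) = refl
  ν-involutive (just (j , 1F)) = refl

  twisted : CommutativeQuasigroup Q
  twisted = record
    { _∙_       = λ x y → ν (x ∙ y)
    ; _\\_      = λ x z → x \\ ν z
    ; ∙-comm    = λ x y → cong ν (∙-comm x y)
    ; \\-solves = λ x z → trans (cong ν (\\-solves x (ν z))) (ν-involutive z)
    ; \\-unique = λ x y → trans (cong (x \\_) (ν-involutive (x ∙ y))) (\\-unique x y)
    }
    where open CommutativeQuasigroup G

  table : Fin 3 → CommutativeQuasigroup Q
  table 0F = G
  table 1F = G
  table 2F = twisted

  _≟Q_ : DecidableEquality Q
  _≟Q_ = Maybe.≡-dec (Product.≡-dec Fin._≟_ Fin._≟_)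

  open Bose _≟Q_ table (λ _ → false) (λ ())
    using (Point; system; diagonal; third-diagonal; third-nothing)

  _≟P_ : DecidableEquality Point
  _≟P_ = Product.≡-dec _≟Q_ Fin._≟_

  successor : Point → Point
  successor (x , 0F) = x , 1F
  successor (x , 1F) = x , 2F
  successor (x , 2F) = ν x , 0F

  diagonal≡successor : ∀ p → diagonal p ≡ successor p
  diagonal≡successor (x , 0F) = cong (_, 1F) (idem x)
  diagonal≡successor (x , 1F) = cong (_, 2F) (idem x)
  diagonal≡successor (x , 2F) = cong (λ u → ν u , 0F) (idem x)

  successor-free : ∀ p → PTS.third system p (successor p) ≡ nothing
  successor-free p = trans (cong (PTS.third system p) (sym (diagonal≡successor p))) (third-diagonal p refl)

  -- The two perfect matchings of each hexagon, one per new point; both fix the three points over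
  -- the origin.
  σ τ : Point → Point
  σ p@(nothing       , _)  = p
  σ (just (j , 0F) , 0F) = just (j , 0F) , 1F
  σ (just (j , 0F) , 1F) = just (j , 0F) , 0F
  σ (just (j , 0F) , 2F) = just (j , 1F) , 0F
  σ (just (j , 1F) , 0F) = just (j , 0F) , 2F
  σ (just (j , 1F) , 1F) = just (j , 1F) , 2F
  σ (just (j , 1F) , 2F) = just (j , 1F) , 1F
  τ p@(nothing       , _)  = p
  τ (just (j , 0F) , 0F) = just (j , 1F) , 2F
  τ (just (j , 0F) , 1F) = just (j , 0F) , 2F
  τ (just (j , 0F) , 2F) = just (j , 0F) , 1F
  τ (just (j , 1F) , 0F) = just (j , 1F) , 1F
  τ (just (j , 1F) , 1F) = just (j , 1F) , 0F
  τ (just (j , 1F) , 2F) = just (j , 0F) , 0F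

  -- Along a hexagon one of `σ` and `τ` steps forward and the other back, with the roles alternating
  -- from point to point.
  data Orbit : Point → Set where
    origin : ∀ i → Orbit (nothing , i)
    στ     : ∀ {p} → σ p ≡ successor p → successor (τ p) ≡ p → Orbit p
    τσ     : ∀ {p} → τ p ≡ successor p → successor (σ p) ≡ p → Orbit p

  orbit : ∀ p → Orbit p
  orbit (nothing , i)         = origin i
  orbit (just (j , 0F) , 0F) = στ refl refl
  orbit (just (j , 0F) , 1F) = τσ refl refl
  orbit (just (j , 0F) , 2F) = στ refl refl
  orbit (just (j , 1F) , 0F) = τσ refl refl
  orbit (just (j , 1F) , 1F) = στ refl refl
  orbit (just (j , 1F) , 2F) = τσ refl refl

  σ-involutive : ∀ p → σ (σ p) ≡ p
  σ-involutive (nothing , _)         = refl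
  σ-involutive (just (j , 0F) , 0F) = refl
  σ-involutive (just (j , 0F) , 1F) = refl
  σ-involutive (just (j , 0F) , 2F) = refl
  σ-involutive (just (j , 1F) , 0F) = refl
  σ-involutive (just (j , 1F) , 1F) = refl
  σ-involutive (just (j , 1F) , 2F) = refl

  τ-involutive : ∀ p → τ (τ p) ≡ p
  τ-involutive (nothing , _)         = refl
  τ-involutive (just (j , 0F) , 0F) = refl
  τ-involutive (just (j , 0F) , 1F) = refl
  τ-involutive (just (j , 0F) , 2F) = refl
  τ-involutive (just (j , 1F) , 0F) = refl
  τ-involutive (just (j , 1F) , 1F) = refl
  τ-involutive (just (j , 1F) , 2F) = refl

  σ≢τ : ∀ p → σ p ≡ τ p → proj₁ p ≡ nothing
  σ≢τ (nothing , _) _ = refl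
  σ≢τ (just (j , 0F) , 0F) ()
  σ≢τ (just (j , 0F) , 1F) ()
  σ≢τ (just (j , 0F) , 2F) ()
  σ≢τ (just (j , 1F) , 0F) ()
  σ≢τ (just (j , 1F) , 1F) ()
  σ≢τ (just (j , 1F) , 2F) ()

  σ-fixed : ∀ p → σ p ≡ p → proj₁ p ≡ nothing
  σ-fixed (nothing , _) _ = refl
  σ-fixed (just (j , 0F) , 0F) ()
  σ-fixed (just (j , 0F) , 1F) ()
  σ-fixed (just (j , 0F) , 2F) ()
  σ-fixed (just (j , 1F) , 0F) ()
  σ-fixed (just (j , 1F) , 1F) ()
  σ-fixed (just (j , 1F) , 2F) ()

  τ-fixed : ∀ p → τ p ≡ p → proj₁ p ≡ nothing
  τ-fixed (nothing , _) _ = refl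
  τ-fixed (just (j , 0F) , 0F) ()
  τ-fixed (just (j , 0F) , 1F) ()
  τ-fixed (just (j , 0F) , 2F) ()
  τ-fixed (just (j , 1F) , 0F) ()
  τ-fixed (just (j , 1F) , 1F) ()
  τ-fixed (just (j , 1F) , 2F) ()

  predecessor-free : ∀ {p q} → successor q ≡ p → PTS.third system p q ≡ nothing
  predecessor-free {q = q} refl = trans (PTS.comm system (successor q) q) (successor-free q)

  σ-free : ∀ p → PTS.third system p (σ p) ≡ nothing
  σ-free p with orbit p
  ... | origin i  = PTS.irrefl system (nothing , i)
  ... | στ s _    = trans (cong (PTS.third system p) s) (successor-free p)
  ... | τσ _ s    = predecessor-free s

  τ-free : ∀ p → PTS.third system p (τ p) ≡ nothing
  τ-free p with orbit p
  ... | origin i  = PTS.irrefl system (nothing , i)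
  ... | στ _ s    = predecessor-free s
  ... | τσ s _    = trans (cong (PTS.third system p) s) (successor-free p)

  module C₁ = Cone _≟P_ system σ σ-involutive σ-free

  -- It fixes the first new point, so the two new points stay unjoined and both enter the hole.
  τ⁺ : Maybe Point → Maybe Point
  τ⁺ = Maybe.map τ

  τ⁺-involutive : ∀ p → τ⁺ (τ⁺ p) ≡ p
  τ⁺-involutive nothing  = refl
  τ⁺-involutive (just p) = cong just (τ-involutive p)

  -- The first new point covers only the pairs of `σ`, and away from the origin `σ` and `τ` differ
  -- everywhere.
  τ⁺-free : ∀ p → C₁.third p (τ⁺ p) ≡ nothing
  τ⁺-free nothing  = refl
  τ⁺-free (just p) = trans (C₁.third-new p (τ p) (τ-free p)) (C₁.chord-other p (τ p) (apart p))
    where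
    apart : ∀ p → σ p ≢ τ p ⊎ p ≡ τ p
    apart p@(nothing , _) = inj₂ refl
    apart p@(just _  , _) = inj₁ λ eq → just≢nothing refl (σ≢τ p eq)

  module C₂ = Cone (Maybe.≡-dec _≟P_) C₁.cone τ⁺ τ⁺-involutive τ⁺-free

  hole : Fin 5 → Maybe (Maybe Point)
  hole zero          = nothing
  hole (suc zero)    = just nothing
  hole (suc (suc i)) = just (just (nothing , i))

  hole-injective : ∀ i j → hole i ≡ hole j → i ≡ j
  hole-injective zero          zero          _    = refl
  hole-injective (suc zero)    (suc zero)    _    = refl
  hole-injective (suc (suc i)) (suc (suc j)) refl = refl
  hole-injective zero          (suc zero)    ()
  hole-injective zero          (suc (suc j)) ()
  hole-injective (suc zero)    zero          ()
  hole-injective (suc zero)    (suc (suc j)) ()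
  hole-injective (suc (suc i)) zero          ()
  hole-injective (suc (suc i)) (suc zero)    ()

  origins-free : ∀ i j → PTS.third system (nothing , i) (nothing , j) ≡ nothing
  origins-free 0F 0F = PTS.irrefl system (nothing , 0F)
  origins-free 1F 1F = PTS.irrefl system (nothing , 1F)
  origins-free 2F 2F = PTS.irrefl system (nothing , 2F)
  origins-free 0F 1F = successor-free (nothing , 0F)
  origins-free 1F 2F = successor-free (nothing , 1F)
  origins-free 2F 0F = successor-free (nothing , 2F)
  origins-free 1F 0F = predecessor-free {q = nothing , 0F} refl
  origins-free 2F 1F = predecessor-free {q = nothing , 1F} refl
  origins-free 0F 2F = predecessor-free {q = nothing , 2F} refl

  hole-empty : ∀ i j → C₂.third (hole i) (hole j) ≡ nothing
  hole-empty zero          zero          = refl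
  hole-empty zero          (suc zero)    = C₂.apex-fixed nothing refl
  hole-empty zero          (suc (suc j)) = C₂.apex-fixed (just (nothing , j)) refl
  hole-empty (suc zero)    zero          = C₂.apex-fixed nothing refl
  hole-empty (suc (suc i)) zero          = C₂.apex-fixed (just (nothing , i)) refl
  hole-empty (suc zero)    (suc zero)    = C₂.third-irrefl (just nothing)
  hole-empty (suc zero)    (suc (suc j)) =
    trans (C₂.third-new nothing (just (nothing , j)) (C₁.apex-fixed (nothing , j) refl))
      (C₂.chord-other nothing (just (nothing , j)) (inj₁ λ ()))
  hole-empty (suc (suc i)) (suc zero)    =
    trans (C₂.third-new (just (nothing , i)) nothing (C₁.apex-fixed (nothing , i) refl))
      (C₂.chord-other (just (nothing , i)) nothing (inj₁ λ ()))
  hole-empty (suc (suc i)) (suc (suc j)) with i Fin.≟ j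
  ... | yes refl = C₂.third-irrefl (hole (suc (suc i)))
  ... | no i≢j   = trans
    (C₂.third-new (just p) (just q) (trans (C₁.third-new p q (origins-free i j))
      (C₁.chord-other p q (inj₁ λ { refl → i≢j refl }))))
    (C₂.chord-other (just p) (just q) (inj₁ λ { refl → i≢j refl }))
    where
    p q : Point
    p = nothing , i
    q = nothing , j

  InHole : Maybe (Maybe Point) → Set
  InHole x = ∃[ i ] x ≡ hole i

  origin-InHole : ∀ p → proj₁ p ≡ nothing → InHole (just (just p))
  origin-InHole (nothing , i) refl = suc (suc i) , refl

  -- A free diagonal pair misses both matchings, so it lies over the origin.
  diagonal-InHole : ∀ p → σ p ≢ successor p → τ p ≢ successor p →
                    InHole (just (just p)) × InHole (just (just (successor p)))
  diagonal-InHole p σ≢ τ≢ with orbit p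
  ... | στ s _    = ⊥-elim (σ≢ s)
  ... | τσ s _    = ⊥-elim (τ≢ s)
  ... | origin 0F = (2F , refl) , (3F , refl)
  ... | origin 1F = (3F , refl) , (4F , refl)
  ... | origin 2F = (4F , refl) , (2F , refl)

  hole-cover : ∀ {x y} → x ≢ y → C₂.third x y ≡ nothing → InHole x × InHole y
  hole-cover {nothing} {nothing} x≢y _ = ⊥-elim (x≢y refl)
  hole-cover {nothing} {just nothing} _ _ = (0F , refl) , (1F , refl)
  hole-cover {just nothing} {nothing} _ _ = (1F , refl) , (0F , refl)
  hole-cover {nothing} {just (just q)} _ eq =
    (0F , refl) , origin-InHole q (τ-fixed q (Maybe.just-injective (C₂.apex-nothing {just q} eq)))
  hole-cover {just (just p)} {nothing} _ eq =
    origin-InHole p (τ-fixed p (Maybe.just-injective (C₂.apex-nothing {just p} eq))) , (0F , refl)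
  hole-cover {just nothing} {just nothing} x≢y _ = ⊥-elim (x≢y refl)
  hole-cover {just nothing} {just (just q)} x≢y eq =
    (1F , refl) , origin-InHole q (σ-fixed q (C₁.apex-nothing (proj₁ (C₂.third-nothing (x≢y ∘ cong just) eq))))
  hole-cover {just (just p)} {just nothing} x≢y eq =
    origin-InHole p (σ-fixed p (C₁.apex-nothing (proj₁ (C₂.third-nothing (x≢y ∘ cong just) eq)))) , (1F , refl)
  hole-cover {just (just p)} {just (just q)} x≢y eq with C₂.third-nothing (x≢y ∘ cong just) eq
  ... | free₂ , τ≢ with C₁.third-nothing (x≢y ∘ cong (just ∘ just)) free₂
  ...   | free₁ , σ≢ with third-nothing p q (x≢y ∘ cong (just ∘ just)) free₁
  ...     | inj₁ (d , _) with refl ← trans (sym d) (diagonal≡successor p) =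
              diagonal-InHole p σ≢ (τ≢ ∘ cong just)
  -- Here `p` is the successor of `q`; since `σ` and `τ` are involutions, missing the pair from `p`
  -- means missing it from `q`.
  ...     | inj₂ (d , _) with refl ← trans (sym d) (diagonal≡successor q) =
              let (inq , inp) = diagonal-InHole q
                    (λ s → σ≢ (trans (cong σ (sym s)) (σ-involutive q)))
                    (λ s → τ≢ (cong just (trans (cong τ (sym s)) (τ-involutive q))))
              in inp , inq

five-hole : ∀ k → FiveHole (4 + k * 2 * 3)
five-hole k = record
  { system    = transport points C₂.cone
  ; hole      = from points ∘ hole
  -- `Maybe-enumeration` gives the outer `nothing`, the second new point, the number `zero`.
  ; hole-zero = refl
  ; injective = λ {i} {j} eq → hole-injective i j (trans (sym (strictlyInverseˡ points (hole i)))
      (trans (cong (to points) eq) (strictlyInverseˡ points (hole j))))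
  ; empty     = λ i j → cong (Maybe.map (from points)) (trans
      (cong₂ C₂.third (strictlyInverseˡ points (hole i)) (strictlyInverseˡ points (hole j))) (hole-empty i j))
  ; cover     = λ {x} {y} x≢y none →
      let (p , q) = hole-cover (x≢y ∘ to-injective points C₂.cone) (nothing-transported points C₂.cone {x} {y} none)
      in pull p , pull q
  }
  where
  labels : Fin (suc (k * 2)) ↔ Maybe (Fin k × Fin 2)
  labels = Maybe-enumeration (Fin.*↔× {k} {2})
  open OddOrder k labels using (midpoint; midpoint-idem)
  open Hexagons k midpoint midpoint-idem
  points : Fin (5 + k * 2 * 3) ↔ Maybe (Maybe (Q × Fin 3))
  points = Maybe-enumeration (Maybe-enumeration ((labels ×-↔ ↔-id (Fin 3)) ↔-∘ Fin.*↔× {suc (k * 2)} {3}))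
  pull : ∀ {x} → InHole (to points x) → ∃[ i ] x ≡ from points (hole i)
  pull {x} (i , eq) = i , trans (sym (strictlyInverseʳ points x)) (cong (from points) eq)

-- The residue classes together

residue-lower : ∀ r t → 4 ≤ r + t * 6 → r < 6 → Lower (r + t * 6)
-- The constructions have sizes in the form `t * 2 * 3`, hence the `subst` along `*-assoc` in every
-- case. Residues 0 and 2 use a Steiner system with one point more.
residue-lower 0 (suc t) _ _ = subst (λ u → Lower (6 + u)) (*-assoc t 2 3)
  (lower-steiner-deleted (proj₁ (steiner-1 t)) (proj₂ (steiner-1 t)) (subst (λ u → 6 + u + 12 ≤ 2 * f (6 + u))
    (sym (*-assoc t 2 3)) (≤-reflexive (trans (e t) (cong (2 *_) (sym (f-0 (suc t))))))))
  where
  e : ∀ t → 6 + t * 6 + 12 ≡ 2 * (3 * suc t + 6)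
  e = solve-∀
residue-lower 1 (suc t) _ _ = subst (λ u → Lower (7 + u)) (*-assoc t 2 3)
  (lower-steiner (proj₁ (steiner-1 t)) (proj₂ (steiner-1 t))
    (subst (λ u → f (7 + u) ≡ 9) (sym (*-assoc t 2 3)) (f-residue 1 (suc t))))
residue-lower 2 (suc t) _ _ = subst (λ u → Lower (8 + u)) (*-assoc t 2 3)
  (lower-steiner-deleted (proj₁ (steiner-3 (suc t))) (proj₂ (steiner-3 (suc t))) (subst (λ u → 8 + u + 12 ≤ 2 * f (8 + u))
    (sym (*-assoc t 2 3)) (≤-reflexive (trans (e t) (cong (2 *_) (sym (f-2 (suc t))))))))
  where
  e : ∀ t → 8 + t * 6 + 12 ≡ 2 * (3 * suc t + 7)
  e = solve-∀
residue-lower 3 (suc t) _ _ = subst (λ u → Lower (9 + u)) (*-assoc t 2 3)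
  (lower-steiner (proj₁ (steiner-3 (suc t))) (proj₂ (steiner-3 (suc t)))
    (subst (λ u → f (9 + u) ≡ 9) (sym (*-assoc t 2 3)) (f-residue 3 (suc t))))
-- For t = 0 the hole is the whole system, which covers n = 4 here and n = 5 in the next case.
residue-lower 4 t _ _ = subst (λ u → Lower (4 + u)) (*-assoc t 2 3)
  (lower-hole-deleted (five-hole t) (subst (λ u → 4 + u + 8 ≤ 2 * f (4 + u)) (sym (*-assoc t 2 3))
    (≤-reflexive (trans (e t) (cong (2 *_) (sym (f-4 t)))))))
  where
  e : ∀ t → 4 + t * 6 + 8 ≡ 2 * (3 * t + 6)
  e = solve-∀
residue-lower 5 t _ _ = subst (λ u → Lower (5 + u)) (*-assoc t 2 3)
  (lower-hole (five-hole t) (subst (λ u → f (5 + u) ≡ 7) (sym (*-assoc t 2 3)) (f-residue 5 t)))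
residue-lower 0 zero () _
residue-lower 1 zero (s≤s ()) _
residue-lower 2 zero (s≤s (s≤s ())) _
residue-lower 3 zero (s≤s (s≤s (s≤s ()))) _
residue-lower (suc (suc (suc (suc (suc (suc _)))))) _ _ (s≤s (s≤s (s≤s (s≤s (s≤s (s≤s ()))))))

residue-upper : ∀ r t → r < 6 → Upper (r + t * 6)
residue-upper 0 t _ = upper-0 t
residue-upper 1 t _ = upper-1 t
residue-upper 2 t _ = upper-2 t
residue-upper 3 t _ = upper-3 t
residue-upper 4 t _ = upper-4 t
residue-upper 5 t _ = upper-5 t
residue-upper (suc (suc (suc (suc (suc (suc _)))))) _ (s≤s (s≤s (s≤s (s≤s (s≤s (s≤s ()))))))

theorem4p5 : (n : ℕ) → 4 ≤ n →
    ∃[ k ] (IsMK4e n k × 3 * k + f n ≡ n C 2)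
theorem4p5 n 4≤n = upper∧lower
  (subst Upper (sym n≡) (residue-upper (n % 6) (n / 6) (m%n<n n 6)))
  (subst Lower (sym n≡) (residue-lower (n % 6) (n / 6) (subst (4 ≤_) n≡ 4≤n) (m%n<n n 6)))
  where
  n≡ : n ≡ n % 6 + n / 6 * 6
  n≡ = m≡m%n+[m/n]*n n 6
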